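{- Let \texttt{G-DCST}$^*$ denote the problem \texttt{G-DCST} restricted to instances $(G',D',\ell,2)$ (upper bound function constantly $2$) such that $\ell(e)\in\{0,1\}$ for every $e\in E(G')$ and the maximum in-degree of $D'$ is $\Delta^-(D')=2$. Then there is a polynomial-time reduction from \texttt{FCST} to \texttt{G-DCST}$^*$.
   Context: For a graph $G$ and a digraph $D$ with vertex set $E(G)$, let $\mathrm{dep}(e)=\{e'\in E(G):(e',e)\in E(D)\}$. Given $\ell,u:E(G)\to\mathbb{N}$, a subgraph $H$ of $G$ $(\ell,u)$-satisfies $D$ if $\ell(e)\le|\mathrm{dep}(e)\cap E(H)|\le u(e)$ for every $e\in E(H)$. \texttt{G-DCST} asks, given $(G,D,\ell,u)$, whether $G$ has a spanning tree that $(\ell,u)$-satisfies $D$. \texttt{FCST} (Forcing Constrained Spanning Tree): given a graph $G$ and an undirected graph $D$ with $V(D)=E(G)$, decide whether $G$ has a spanning tree $T$ with $E(T)\cap\{e,f\}\neq\emptyset$ for every edge $ef\in E(D)$. -}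

module Defs where

open import Data.Bool.Base using (Bool; true; false)
open import Data.Fin.Base using (Fin; zero; toℕ; _<_)
open import Data.Fin.Properties using (_≟_)
open import Data.Fin.Subset using (Subset; _∈_; ∣_∣; _∩_; _∪_; ⁅_⁆; Nonempty)
open import Data.List.Base using
  (List; []; _∷_; [_]; _++_; _∷ʳ_; concatMap; drop; head; length; map; replicate; tabulate; allFin)
open import Data.List.Extrema.Nat using (max)
open import Data.List.Relation.Unary.All using (All)
open import Data.List.Relation.Unary.Linked using (Linked)
open import Data.List.Relation.Unary.Unique.Propositional using (Unique)
open import Data.Maybe.Base using (Maybe; just; nothing)
open import Data.Nat.Base using (ℕ; suc; _+_; _*_; _^_; _≤_; NonZero)
open import Data.Product using (Σ; ∃; ∃-syntax; _×_; _,_; proj₁; proj₂)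
open import Data.Product.Properties using (≡-dec)
open import Data.Sum.Base using (_⊎_)
open import Data.Vec.Base as Vec using (Vec; lookup; _[_]≔_)
open import Function.Base using (_∘_)
open import Function.Bundles using (_⇔_)
open import Function.Definitions using (Injective)
open import Relation.Binary.Construct.Closure.ReflexiveTransitive using (Star)
open import Relation.Binary.PropositionalEquality using (_≡_; _≢_)
open import Relation.Nullary using (¬_)
open import Relation.Nullary.Decidable using (does)

------------------------------------------------------------------------
-- Graphs and digraphs

-- Finite simple graphs with vertex set Fin n and edge set Fin size.
-- An edge {i , j} is stored as the pair (i , j) with i < j.

record Graph (n : ℕ) : Set where
  field
    size    : ℕ
    ends    : Fin size → Fin n × Fin n
    ordered : ∀ e → proj₁ (ends e) < proj₂ (ends e)
    simple  : Injective _≡_ _≡_ ends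

open Graph public

Edge : ∀ {n} → Graph n → Set
Edge G = Fin (size G)

record Digraph (n : ℕ) : Set where
  field
    arcs     : List (Fin n × Fin n)
    loopless : All (λ a → proj₁ a ≢ proj₂ a) arcs
    unique   : Unique arcs

open Digraph public

-- dep D e is the set of in-neighbours of e.

dep : ∀ {n} → Digraph n → Fin n → Subset n
dep D e = Vec.tabulate λ e′ → does ((e′ , e) ∈? arcs D)
  where open import Data.List.Membership.DecPropositional (≡-dec _≟_ _≟_) using (_∈?_)

inDegree : ∀ {n} → Digraph n → Fin n → ℕ
inDegree D e = ∣ dep D e ∣

maxInDegree : ∀ {n} → Digraph n → ℕ
maxInDegree {n} D = max 0 (map (inDegree D) (allFin n))

------------------------------------------------------------------------
-- Spanning trees

-- A spanning subgraph of G is given by its set of edges.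

SpanningSubgraph : ∀ {n} → Graph n → Set
SpanningSubgraph G = Subset (size G)

module _ {n : ℕ} (G : Graph n) (H : SpanningSubgraph G) where

  Adjacent : Fin n → Fin n → Set
  Adjacent v w = ∃[ e ] (e ∈ H × (ends G e ≡ (v , w) ⊎ ends G e ≡ (w , v)))

  Connected : Set
  Connected = NonZero n × (∀ v w → Star Adjacent v w)

  -- The vertices v ∷ ws, in this order, form a cycle.

  IsCycle : Fin n → List (Fin n) → Set
  IsCycle v ws = 2 ≤ length ws × Unique (v ∷ ws) × Linked Adjacent ((v ∷ ws) ∷ʳ v)

  Acyclic : Set
  Acyclic = ∀ v ws → ¬ IsCycle v ws

  IsSpanningTree : Set
  IsSpanningTree = Connected × Acyclic

  Satisfies : Digraph (size G) → (ℓ u : Edge G → ℕ) → Set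
  Satisfies D ℓ u = ∀ e → e ∈ H → ℓ e ≤ ∣ dep D e ∩ H ∣ × ∣ dep D e ∩ H ∣ ≤ u e

------------------------------------------------------------------------
-- Decision problems

record Problem : Set₁ where
  field
    Instance : Set
    encode   : Instance → List Bool
    Yes      : Instance → Set

open Problem public

restrict : (A : Problem) → (Instance A → Set) → Problem
restrict A P = record
  { Instance = Σ (Instance A) P
  ; encode   = encode A ∘ proj₁
  ; Yes      = Yes A ∘ proj₁
  }

-- Numbers are written in unary; every code is self-delimiting.  Since the
-- vertices and edges of a graph are objects of the instance, naming them in
-- unary changes the length only polynomially.

encodeℕ : ℕ → List Bool
encodeℕ n = replicate n true ++ [ false ]

encodeList : {A : Set} → (A → List Bool) → List A → List Bool
encodeList enc xs = concatMap (λ x → true ∷ enc x) xs ++ [ false ]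

encodePair : ∀ {n} → Fin n × Fin n → List Bool
encodePair (i , j) = encodeℕ (toℕ i) ++ encodeℕ (toℕ j)

encodeEdges : ∀ {n} → Graph n → List Bool
encodeEdges G = encodeList encodePair (tabulate (ends G))

encodeArcs : ∀ {n} → Digraph n → List Bool
encodeArcs D = encodeList encodePair (arcs D)

record FCSTInstance : Set where
  field
    n : ℕ
    G : Graph n
    D : Graph (size G)

FCST : Problem
FCST = record
  { Instance = FCSTInstance
  ; encode   = λ I → let open FCSTInstance I in
      encodeℕ n ++ encodeEdges G ++ encodeEdges D
  ; Yes      = λ I → let open FCSTInstance I in
      ∃[ T ] (IsSpanningTree G T ×
              (∀ (d : Edge D) → let (e , f) = ends D d in Nonempty (T ∩ (⁅ e ⁆ ∪ ⁅ f ⁆))))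
  }

record DCSTInstance : Set where
  field
    n   : ℕ
    G   : Graph n
    D   : Digraph (size G)
    ℓ u : Edge G → ℕ

G-DCST : Problem
G-DCST = record
  { Instance = DCSTInstance
  ; encode   = λ I → let open DCSTInstance I in
      encodeℕ n ++ encodeEdges G ++ encodeArcs D ++
      encodeList encodeℕ (tabulate ℓ) ++ encodeList encodeℕ (tabulate u)
  ; Yes      = λ I → let open DCSTInstance I in
      ∃[ T ] (IsSpanningTree G T × Satisfies G T D ℓ u)
  }

G-DCST* : Problem
G-DCST* = restrict G-DCST λ I → let open DCSTInstance I in
  (∀ e → u e ≡ 2) × (∀ e → ℓ e ≡ 0 ⊎ ℓ e ≡ 1) × maxInDegree D ≡ 2

------------------------------------------------------------------------
-- Polynomial time

-- The machine model is that of structured programs over finitely many stacks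
-- of bits, each basic step having unit cost.  It is the multitape Turing
-- machine up to a constant factor in time: a tape is a pair of stacks (with
-- its symbols coded by fixed-length blocks of bits), the control state is a
-- fixed-length block on a further stack, and the transition function is a
-- nest of `case`s inside one `while`; conversely, a program is a finite
-- control for a machine with one tape per stack.

data Prog (k : ℕ) : Set where
  skip  : Prog k
  push  : Fin k → Bool → Prog k
  pop   : Fin k → Prog k
  _⨾_   : Prog k → Prog k → Prog k
  case  : Fin k → (p[] p0 p1 : Prog k) → Prog k
  while : Fin k → Prog k → Prog k

infixr 5 _⨾_

State : ℕ → Set
State k = Vec (List Bool) k

top : ∀ {k} → State k → Fin k → Maybe Bool
top s r = head (lookup s r)

select : {A : Set} → Maybe Bool → A → A → A → A
select nothing      x y z = x
select (just false) x y z = y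
select (just true)  x y z = z

-- p ⊢ s ⇓[ t ] s′ : started in state s, p halts in state s′ after t steps.
-- `while r p` repeats p as long as the top of stack r is true; popping an
-- empty stack has no effect.

infix 4 _⊢_⇓[_]_

data _⊢_⇓[_]_ {k : ℕ} : Prog k → State k → ℕ → State k → Set where
  skip  : ∀ {s} → skip ⊢ s ⇓[ 1 ] s
  push  : ∀ {r b s} → push r b ⊢ s ⇓[ 1 ] s [ r ]≔ (b ∷ lookup s r)
  pop   : ∀ {r s} → pop r ⊢ s ⇓[ 1 ] s [ r ]≔ drop 1 (lookup s r)
  _⨾_   : ∀ {p q s s′ s″ t t′} →
          p ⊢ s ⇓[ t ] s′ → q ⊢ s′ ⇓[ t′ ] s″ → p ⨾ q ⊢ s ⇓[ t + t′ ] s″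
  case  : ∀ {r p[] p0 p1 s s′ t} →
          select (top s r) p[] p0 p1 ⊢ s ⇓[ t ] s′ → case r p[] p0 p1 ⊢ s ⇓[ suc t ] s′
  stop  : ∀ {r p s} → top s r ≢ just true → while r p ⊢ s ⇓[ 1 ] s
  loop  : ∀ {r p s s′ s″ t t′} → top s r ≡ just true →
          p ⊢ s ⇓[ t ] s′ → while r p ⊢ s′ ⇓[ t′ ] s″ → while r p ⊢ s ⇓[ suc (t + t′) ] s″

-- Input and output are on stack zero; the other stacks are initially empty
-- and may hold anything at the end.

PolyTime : (A B : Problem) → (Instance A → Instance B) → Set
PolyTime A B f =
  ∃[ k ] Σ (Prog (suc k)) λ p → ∃[ c ] ∃[ d ] ∀ x →
    ∃[ t ] ∃[ s ] (p ⊢ encode A x Vec.∷ Vec.replicate k [] ⇓[ t ] s ×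
                   lookup s zero ≡ encode B (f x) ×
                   t ≤ c * length (encode A x) ^ d + c)

infix 4 _≤ᵖ_

_≤ᵖ_ : Problem → Problem → Set
A ≤ᵖ B = Σ (Instance A → Instance B) λ f → (∀ x → Yes A x ⇔ Yes B (f x)) × PolyTime A B f

{-# OPTIONS --safe #-}
module Submission where

-- Attach 3 + m leaves to vertex 0 of G, where m is the number of edges of D.
-- A leaf edge lies in every spanning tree, so spanning trees of G and of the
-- extended graph correspond, and a leaf edge t with ℓ t = 1 and dep t = {e , f}
-- says that the tree contains e or f.  Leaf edge 3 + d carries the d-th edge of
-- D in this way; leaf edge 2 depends on leaf edges 0 and 1, which is always
-- satisfied and makes the maximum in-degree 2 even if D has no edges.
--
-- The program parses its input onto separate stacks, keeping lists and counters
-- in unary, and then writes the output from its last bit to its first.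

-- `Satisfies` constrains an edge only when the tree contains it, so the pair `e`, `f` has to be
-- hung on an edge that no spanning tree avoids. Each leaf edge receives at most one pair, so all
-- in-degrees are at most 2 and the constant upper bound holds automatically. Attaching leaves
-- requires a vertex; hence instances on the empty graph are replaced by another no-instance.
-- Running times are hardly ever computed by hand. Bounds are terms of `Poly` in one parameter `L`,
-- mostly left as `_` in the statements about programs and filled in by unification from their
-- proofs. The resulting term mentions neither `L` nor the instance, so it is one bound for all
-- inputs.

open import Data.Bool.Base using (Bool; true; false)
open import Data.Empty using (⊥)
open import Data.Fin.Base using (Fin; zero; suc; toℕ; _↑ˡ_; _↑ʳ_; splitAt; join)
open import Data.Fin.Patterns
open import Data.Fin.Properties using
  (_≟_; toℕ<n; toℕ-↑ˡ; toℕ-↑ʳ; ↑ˡ-injective; ↑ʳ-injective; splitAt-↑ˡ; splitAt-↑ʳ; join-splitAt;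
   suc-injective; <⇒≢)
open import Data.Fin.Subset using
  (Subset; _∈_; _⊆_; ∣_∣; _∩_; _∪_; ⁅_⁆; ⊤; Nonempty; inside; outside)
open import Data.Fin.Subset.Properties using
  (nonempty?; Empty-unique; ∣⊥∣≡0; ∣⁅x⁆∣≡1; x∈⁅x⁆; x∈⁅y⁆⇒x≡y; x∈p∩q⁺; x∈p∩q⁻; x∈p∪q⁺; x∈p∪q⁻;
   p⊆p∪q; q⊆p∪q; p⊆q⇒∣p∣≤∣q∣; p⊂q⇒∣p∣<∣q∣; ∣p∩q∣≤∣p∣; ∈⊤)
open import Data.List.Base using
  (List; []; _∷_; [_]; _++_; _∷ʳ_; _ʳ++_; allFin; concat; drop; foldr; head; length; map; reverse; tabulate)
open import Data.List.Extrema.Nat using (max≤v⁺; v≤max⁺)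
import Data.List.Membership.DecPropositional as DecMembership
open import Data.List.Membership.Propositional using () renaming (_∈_ to _∈ₗ_)
open import Data.List.Membership.Propositional.Properties using
  (∈-allFin; ∈-concat⁺′; ∈-concat⁻′; ∈-map⁺; ∈-tabulate⁺; ∈-tabulate⁻)
open import Data.List.Properties using
  (++-assoc; ++-identityʳ; foldr-++; length-map; length-reverse; length-tabulate; map-++)
open import Data.List.Relation.Binary.Permutation.Propositional using (↭-sym)
open import Data.List.Relation.Binary.Permutation.Propositional.Properties using (↭-reverse; All-resp-↭)
open import Data.List.Relation.Unary.All as All using (All; []; _∷_)
import Data.List.Relation.Unary.All.Properties as Allₚ
open import Data.List.Relation.Unary.AllPairs using ([]; _∷_)
import Data.List.Relation.Unary.AllPairs.Properties as AllPairsₚ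
open import Data.List.Relation.Unary.Any as Any using (here; there)
open import Data.List.Relation.Unary.Linked as Linked using (Linked; _∷_)
import Data.List.Relation.Unary.Linked.Properties as Linkedₚ
open import Data.List.Relation.Unary.Unique.Propositional using (Unique)
import Data.List.Relation.Unary.Unique.Propositional.Properties as Uniqueₚ
open import Data.Maybe.Base using (just)
open import Data.Nat.Base using (ℕ; zero; suc; _+_; _*_; _^_; _≤_; _<_; z≤n; s≤s; z<s)
open import Data.Nat.Properties using
  (*-assoc; *-distribʳ-+; *-distribˡ-+; *-identityʳ; *-identityˡ; *-mono-≤; *-monoʳ-≤; *-monoˡ-≤;
   +-comm; +-identityʳ; +-mono-≤; +-monoʳ-≤; +-monoˡ-≤; +-suc; <-≤-trans; <⇒≤;
   [m*n]*[o*p]≡[m*o]*[n*p]; ^-distribˡ-+-*; ^-monoʳ-≤; ^-monoˡ-≤; m≤m*n; m≤m+n; m≤n+m; n≤1+n;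
   ≤-antisym; ≤-refl; ≤-reflexive; ≤-trans; module ≤-Reasoning)
open import Data.Product as Product using (∃-syntax; _×_; _,_; proj₁; proj₂; swap)
open import Data.Product.Properties using (≡-dec; ,-injectiveʳ; ,-injectiveˡ)
open import Data.Sum.Base as Sum using (_⊎_; inj₁; inj₂; [_,_]′)
open import Data.Unit.Base using () renaming (⊤ to Unit)
open import Data.Vec.Base as Vec using ([]; _∷_; lookup; _[_]≔_)
open import Data.Vec.Properties using
  ([]=⇒lookup; lookup⇒[]=; lookup∘tabulate; lookup∘update; lookup∘update′; lookup-++ˡ; lookup-++ʳ;
   []≔-commutes; []≔-idempotent; []≔-lookup)
open import Function.Base using (_∘_)
open import Function.Bundles using (_⇔_; mk⇔; Equivalence)
open import Relation.Binary.Construct.Closure.ReflexiveTransitive as Star using (Star; ε; _◅_; _◅◅_)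
open import Relation.Binary.PropositionalEquality using
  (_≡_; _≢_; refl; sym; trans; cong; cong₂; subst; subst₂; module ≡-Reasoning)
open import Relation.Nullary using (¬_; Dec; yes; no; contradiction)
open import Relation.Nullary.Decidable using (does; dec-true)

open import Defs

-- Polynomial bounds

data Poly : Set where
  con : ℕ → Poly
  var : Poly
  _⊕_ _⊗_ : Poly → Poly → Poly

infixl 6 _⊕_
infixl 7 _⊗_

⟦_⟧ : Poly → ℕ → ℕ
⟦ con c ⟧ x = c
⟦ var ⟧ x = x
⟦ P ⊕ Q ⟧ x = ⟦ P ⟧ x + ⟦ Q ⟧ x
⟦ P ⊗ Q ⟧ x = ⟦ P ⟧ x * ⟦ Q ⟧ x

-- A sum gets the sum of the degrees, not their maximum: cruder, but sums and products then share
-- one rule for the exponent.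
coefficient degree : Poly → ℕ
coefficient (con c) = c
coefficient var = 1
coefficient (P ⊕ Q) = coefficient P + coefficient Q
coefficient (P ⊗ Q) = coefficient P * coefficient Q
degree (con c) = 0
degree var = 1
degree (P ⊕ Q) = degree P + degree Q
degree (P ⊗ Q) = degree P + degree Q

-- The base is `suc x` so that powers grow with the exponent even at `x = 0`; both summands of a sum
-- can then be raised to the exponent `d + d′`.
⟦⟧≤monomial : ∀ P x → ⟦ P ⟧ x ≤ coefficient P * suc x ^ degree P
⟦⟧≤monomial (con c) x = ≤-reflexive (sym (*-identityʳ c))
⟦⟧≤monomial var x = ≤-trans (n≤1+n x) (≤-reflexive (sym (trans (*-identityˡ _) (*-identityʳ _))))
⟦⟧≤monomial (P ⊕ Q) x = begin
  ⟦ P ⟧ x + ⟦ Q ⟧ x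
    ≤⟨ +-mono-≤ (⟦⟧≤monomial P x) (⟦⟧≤monomial Q x) ⟩
  c * suc x ^ d + c′ * suc x ^ d′
    ≤⟨ +-mono-≤ (*-monoʳ-≤ c (^-monoʳ-≤ (suc x) (m≤m+n d d′))) (*-monoʳ-≤ c′ (^-monoʳ-≤ (suc x) (m≤n+m d′ d))) ⟩
  c * suc x ^ (d + d′) + c′ * suc x ^ (d + d′)
    ≡⟨ *-distribʳ-+ (suc x ^ (d + d′)) c c′ ⟨
  (c + c′) * suc x ^ (d + d′) ∎
  where
  open ≤-Reasoning
  c = coefficient P
  c′ = coefficient Q
  d = degree P
  d′ = degree Q
⟦⟧≤monomial (P ⊗ Q) x = begin
  ⟦ P ⟧ x * ⟦ Q ⟧ x
    ≤⟨ *-mono-≤ (⟦⟧≤monomial P x) (⟦⟧≤monomial Q x) ⟩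
  (c * suc x ^ d) * (c′ * suc x ^ d′)
    ≡⟨ [m*n]*[o*p]≡[m*o]*[n*p] c (suc x ^ d) c′ (suc x ^ d′) ⟩
  (c * c′) * (suc x ^ d * suc x ^ d′)
    ≡⟨ cong (c * c′ *_) (^-distribˡ-+-* (suc x) d d′) ⟨
  (c * c′) * suc x ^ (d + d′) ∎
  where
  open ≤-Reasoning
  c = coefficient P
  c′ = coefficient Q
  d = degree P
  d′ = degree Q

*-^-distribˡ : ∀ m n d → (m * n) ^ d ≡ m ^ d * n ^ d
*-^-distribˡ m n zero = refl
*-^-distribˡ m n (suc d) =
  trans (cong (m * n *_) (*-^-distribˡ m n d)) ([m*n]*[o*p]≡[m*o]*[n*p] m n (m ^ d) (n ^ d))

-- For positive `x`, `k + x ≤ suc k * x`. The additive term covers `x = 0`, where `x ^ d` may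
-- vanish, and matches the shape `c * n ^ d + c` of the bound in `PolyTime`.
[k+x]^d≤ : ∀ k d x → (k + x) ^ d ≤ suc k ^ d * x ^ d + suc k ^ d
[k+x]^d≤ k d zero = ≤-trans (^-monoˡ-≤ d (≤-trans (≤-reflexive (+-identityʳ k)) (n≤1+n k))) (m≤n+m _ _)
[k+x]^d≤ k d x@(suc _) = begin
  (k + x) ^ d       ≤⟨ ^-monoˡ-≤ d (+-monoˡ-≤ x (m≤m*n k x)) ⟩
  (k * x + x) ^ d   ≡⟨ cong (_^ d) (+-comm (k * x) x) ⟩
  (suc k * x) ^ d   ≡⟨ *-^-distribˡ (suc k) x d ⟩
  suc k ^ d * x ^ d ≤⟨ m≤m+n _ _ ⟩
  suc k ^ d * x ^ d + suc k ^ d ∎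
  where open ≤-Reasoning

⟦⟧-polynomial : ∀ P k → ∃[ c ] ∃[ d ] ∀ x → ⟦ P ⟧ (k + x) ≤ c * x ^ d + c
⟦⟧-polynomial P k = c * suc (suc k) ^ d , d , λ x → begin
  ⟦ P ⟧ (k + x)                     ≤⟨ ⟦⟧≤monomial P (k + x) ⟩
  c * (suc k + x) ^ d               ≤⟨ *-monoʳ-≤ c ([k+x]^d≤ (suc k) d x) ⟩
  c * (b * x ^ d + b)               ≡⟨ *-distribˡ-+ c (b * x ^ d) b ⟩
  c * (b * x ^ d) + c * b           ≡⟨ cong (_+ c * b) (*-assoc c b (x ^ d)) ⟨
  c * b * x ^ d + c * b ∎
  where
  open ≤-Reasoning
  c = coefficient P
  d = degree P
  b = suc (suc k) ^ d

-- Loops of timed programs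

ones : ℕ → List Bool → List Bool
ones zero r = r
ones (suc k) r = true ∷ ones k r

ones-suc : ∀ k r → ones k (true ∷ r) ≡ true ∷ ones k r
ones-suc zero r = refl
ones-suc (suc k) r = cong (true ∷_) (ones-suc k r)

-- `f` is given the number of rounds still to come, so the outermost application is that of `f 0`.
iterateℕ : {B : Set} → (ℕ → B → B) → ℕ → B → B
iterateℕ f zero b = b
iterateℕ f (suc k) b = iterateℕ f k (f k b)

-- The step sees the rest of the list because the programs keep its length in a counter.
iterateList : {A B : Set} → (List A → A → B → B) → List A → B → B
iterateList f [] b = b
iterateList f (x ∷ xs) b = iterateList f xs (f xs x b)

iterateℕ-true : ∀ k r → iterateℕ (λ _ → true ∷_) k r ≡ ones k r
iterateℕ-true zero r = refl
iterateℕ-true (suc k) r = trans (iterateℕ-true k (true ∷ r)) (ones-suc k r)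

move : ∀ {k} → Fin k → Fin k → Prog k
move a b = while a (pop a ⨾ push b true)

-- Running straight-line code as a single step keeps intermediate states small:
-- the rules for push and pop mention their state twice.
StraightLine : ∀ {k} → Prog k → Set
StraightLine (push _ _) = Unit
StraightLine (pop _) = Unit
StraightLine (p ⨾ q) = StraightLine p × StraightLine q
StraightLine _ = ⊥

exec : ∀ {k} → Prog k → State k → State k
exec (push r b) s = s [ r ]≔ (b ∷ lookup s r)
exec (pop r) s = s [ r ]≔ drop 1 (lookup s r)
exec (p ⨾ q) s = exec q (exec p s)
exec _ s = s

cost : ∀ {k} → Prog k → ℕ
cost (p ⨾ q) = cost p + cost q
cost _ = 1

straightLine-run : ∀ {k} (p : Prog k) → StraightLine p → ∀ s → p ⊢ s ⇓[ cost p ] exec p s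
straightLine-run (push _ _) _ _ = push
straightLine-run (pop _) _ _ = pop
straightLine-run (p ⨾ q) (lp , lq) s = straightLine-run p lp s ⨾ straightLine-run q lq (exec p s)

-- A lemma p! specifies the program p; L bounds all numbers and lengths that p meets.
module Timed (L : ℕ) where

  infix 4 _⊢_⇓≤[_]_
  infixr 5 _▹_

  record _⊢_⇓≤[_]_ {k} (p : Prog k) (s : State k) (P : Poly) (s′ : State k) : Set where
    constructor timed
    field
      {steps} : ℕ
      run     : p ⊢ s ⇓[ steps ] s′
      steps≤  : steps ≤ ⟦ P ⟧ L

  open _⊢_⇓≤[_]_ public

  private variable
    k : ℕ
    p q : Prog k
    s s′ s″ : State k
    P Q : Poly
    A B : Set

  -- For a concrete straight-line `p` the implicit argument is a product of unit types, which eta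
  -- fills in.
  ops! : {_ : StraightLine p} → p ⊢ s ⇓≤[ con (cost p) ] exec p s
  ops! {_} {_} {_} {line} = timed (straightLine-run _ line _) ≤-refl

  _▹_ : p ⊢ s ⇓≤[ P ] s′ → q ⊢ s′ ⇓≤[ Q ] s″ → p ⨾ q ⊢ s ⇓≤[ P ⊕ Q ] s″
  timed r b ▹ timed r′ b′ = timed (r ⨾ r′) (+-mono-≤ b b′)

  case! : ∀ {r p[] p0 p1} → select (top s r) p[] p0 p1 ⊢ s ⇓≤[ P ] s′ →
          case r p[] p0 p1 ⊢ s ⇓≤[ con 1 ⊕ P ] s′
  case! (timed r b) = timed (case r) (s≤s b)

  from-≡ : s ≡ s′ → p ⊢ s ⇓≤[ P ] s″ → p ⊢ s′ ⇓≤[ P ] s″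
  from-≡ refl r = r

  to-≡ : s′ ≡ s″ → p ⊢ s ⇓≤[ P ] s′ → p ⊢ s ⇓≤[ P ] s″
  to-≡ refl r = r

  -- Each round pays for its test and its body, and the failing test costs one more step. The number
  -- of rounds is replaced by its bound `L`, which keeps the term independent of the data.
  loopPoly : Poly → Poly
  loopPoly P = con 1 ⊕ var ⊗ (con 1 ⊕ P)

  private
    step≤ : ∀ {m t t′ x} → t ≤ x → t′ ≤ 1 + m * (1 + x) → suc (t + t′) ≤ 1 + suc m * (1 + x)
    step≤ {m} {t} {t′} {x} t≤ t′≤ = s≤s (begin
      t + t′                  ≤⟨ +-mono-≤ t≤ t′≤ ⟩
      x + suc (m * (1 + x))   ≡⟨ +-suc x _ ⟩
      suc m * (1 + x)         ∎)
      where open ≤-Reasoning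

  -- `S n b` is the state with `n` rounds to go and `b` accumulated. The body is asked only for
  -- `n < N`, so its proof may use bounds on `N`.
  while-ℕ : ∀ {r} (S : ℕ → B → State k) (f : ℕ → B → B) →
            (∀ b → top (S 0 b) r ≢ just true) →
            (∀ n b → top (S (suc n) b) r ≡ just true) →
            ∀ N b → N ≤ L →
            (∀ n b → n < N → p ⊢ S (suc n) b ⇓≤[ P ] S n (f n b)) →
            while r p ⊢ S N b ⇓≤[ loopPoly P ] S 0 (iterateℕ f N b)
  while-ℕ {p = p} {P = P} {r = r} S f end next N b N≤L body =
    let t , run , t≤ = go N b ≤-refl in timed run (≤-trans t≤ (s≤s (*-monoˡ-≤ (1 + ⟦ P ⟧ L) N≤L)))
    where
    go : ∀ n b → n ≤ N → ∃[ t ] (while r p ⊢ S n b ⇓[ t ] S 0 (iterateℕ f n b) × t ≤ 1 + n * (1 + ⟦ P ⟧ L))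
    go zero b _ = 1 , stop (end b) , ≤-refl
    go (suc n) b n<N with body n b n<N | go n (f n b) (<⇒≤ n<N)
    ... | timed run t≤ | t′ , run′ , t′≤ = _ , loop (next n b) run run′ , step≤ {n} t≤ t′≤

  while-list : ∀ {r} (S : List A → B → State k) (f : List A → A → B → B) (R : A → Set) →
               (∀ b → top (S [] b) r ≢ just true) →
               (∀ x xs b → top (S (x ∷ xs) b) r ≡ just true) →
               ∀ ys b → All R ys → length ys ≤ L →
               (∀ {x} → R x → ∀ xs b → length xs < length ys → p ⊢ S (x ∷ xs) b ⇓≤[ P ] S xs (f xs x b)) →
               while r p ⊢ S ys b ⇓≤[ loopPoly P ] S [] (iterateList f ys b)
  while-list {p = p} {P = P} {r = r} S f R end next ys b all N≤L body =
    let t , run , t≤ = go ys b all ≤-refl in timed run (≤-trans t≤ (s≤s (*-monoˡ-≤ (1 + ⟦ P ⟧ L) N≤L)))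
    where
    go : ∀ xs b → All R xs → length xs ≤ length ys →
         ∃[ t ] (while r p ⊢ S xs b ⇓[ t ] S [] (iterateList f xs b) × t ≤ 1 + length xs * (1 + ⟦ P ⟧ L))
    go [] b _ _ = 1 , stop (end b) , ≤-refl
    go (x ∷ xs) b (Rx ∷ all) n<N with body Rx xs b n<N | go xs (f xs x b) all (<⇒≤ n<N)
    ... | timed run t≤ | t′ , run′ , t′≤ =
      _ , loop (next x xs b) run run′ , step≤ {length xs} t≤ t′≤

  move! : ∀ {a b : Fin k} → a ≢ b → ∀ n r s → n ≤ L → lookup s a ≡ ones n r → head r ≢ just true →
          move a b ⊢ s ⇓≤[ loopPoly (con 2) ] (s [ a ]≔ r) [ b ]≔ ones n (lookup s b)
  move! {k} {a} {b} a≢b n r s n≤L sa≡ r≢ =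
    subst₂ (λ s₁ x → move a b ⊢ s₁ ⇓≤[ _ ] S 0 x) start (iterateℕ-true n _)
      (while-ℕ S (λ _ → true ∷_)
        (λ y → r≢ ∘ trans (cong head (sym (Sa r y))))
        (λ m y → cong head (Sa (ones (suc m) r) y))
        n (lookup s b) n≤L
        (λ m y _ → subst (_ ⊢ S (suc m) y ⇓≤[ _ ]_) (end m y) ops!))
    where
    st : List Bool → List Bool → State k
    st x y = (s [ a ]≔ x) [ b ]≔ y
    S : ℕ → List Bool → State k
    S m = st (ones m r)
    Sa : ∀ x y → lookup (st x y) a ≡ x
    Sa x y = trans (lookup∘update′ a≢b (s [ a ]≔ x) y) (lookup∘update a s x)
    seta : ∀ x x′ y → st x y [ a ]≔ x′ ≡ st x′ y
    seta x x′ y = trans (sym ([]≔-commutes _ a b a≢b)) (cong (_[ b ]≔ y) ([]≔-idempotent s a))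
    start : S n (lookup s b) ≡ s
    start = trans (cong (λ x → st x (lookup s b)) (sym sa≡))
                  (trans (cong (_[ b ]≔ lookup s b) ([]≔-lookup s a)) ([]≔-lookup s b))
    end : ∀ m y → _ ≡ S m (true ∷ y)
    end m y = begin
      s₁ [ b ]≔ (true ∷ lookup s₁ b)  ≡⟨ cong (λ s → s [ b ]≔ (true ∷ lookup s b)) eq ⟩
      S m y [ b ]≔ (true ∷ lookup (S m y) b)
        ≡⟨ cong (λ z → S m y [ b ]≔ (true ∷ z)) (lookup∘update b (s [ a ]≔ ones m r) y) ⟩
      S m y [ b ]≔ (true ∷ y)         ≡⟨ []≔-idempotent _ b ⟩
      S m (true ∷ y)                  ∎
      where
      open ≡-Reasoning
      s₁ = S (suc m) y [ a ]≔ drop 1 (lookup (S (suc m) y) a)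
      eq : s₁ ≡ S m y
      eq = trans (cong (λ z → S (suc m) y [ a ]≔ drop 1 z) (Sa _ y)) (seta _ _ y)

-- The program

-- …On x r is the code of x followed by r.
pairOn : ℕ × ℕ → List Bool → List Bool
pairOn (i , j) r = true ∷ ones i (false ∷ ones j (false ∷ r))

pairsOn stored : List (ℕ × ℕ) → List Bool → List Bool
pairsOn ps r = foldr pairOn r ps
stored ps r = foldr (pairOn ∘ swap) r ps

-- io input, later output      v  vertex counter           e  edges of G
-- c  target of an arc         u  length of the list u     z  zeros in the list ℓ
-- d  edges of D               w  ones in the list ℓ       p  leaves still to write
-- b  scratch; u is reused to count the leaves already written
pattern #io = 0F
pattern #v = 1F
pattern #e = 2F
pattern #c = 3F
pattern #u = 4F
pattern #z = 5F
pattern #d = 6F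
pattern #w = 7F
pattern #p = 8F
pattern #b = 9F

-- Writing out a unary counter destroys it; the second copy allows it to be restored by pumping
-- back.
pump : ∀ {k} → Fin k → Fin k → Fin k → Prog k
pump a b c = while a (pop a ⨾ push b true ⨾ push c true)

-- Moving a pair of numbers swaps them, whence the swap in stored.
transfer : ∀ {k} → Fin k → Fin k → Prog k
transfer a b =
  push b false ⨾ move a b ⨾ (pop a ⨾ push b false) ⨾ move a b ⨾ pop a ⨾ push b true

readVertices readEdges readConstraints : Prog 10
readVertices = move #io #v ⨾ pop #io
readEdges =
  while #io ((pop #io ⨾ push #c true ⨾ push #u true ⨾ push #z true) ⨾ transfer #io #e) ⨾ pop #io
readConstraints =
  while #io ((pop #io ⨾ push #v true ⨾ push #c true ⨾ push #u true ⨾ push #w true ⨾ push #p true) ⨾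
    transfer #io #d) ⨾ pop #io

initialise : Prog 10
initialise =
  -- The constants come from leaves 0, 1 and 2: three more vertices (`#v`), edges (`#u`) and leaves
  -- to write (`#p`). Leaf edges 0 and 1 have lower bound 0 (`#z`), leaf edge 2 has lower bound 1
  -- (`#w`).
  push #v true ⨾ push #v true ⨾ push #v true ⨾ push #u true ⨾ push #u true ⨾ push #u true ⨾
  push #z true ⨾ push #z true ⨾ push #w true ⨾ push #p true ⨾ push #p true ⨾ push #p true

writeUpper writeLower writeArcs writePendants writeEdges writeVertices : Prog 10
writeUpper = push #io false ⨾
  while #u (pop #u ⨾ push #io false ⨾ push #io true ⨾ push #io true ⨾ push #io true)
writeLower = push #io false ⨾
  while #w (pop #w ⨾ push #io false ⨾ push #io true ⨾ push #io true) ⨾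
  while #z (pop #z ⨾ push #io false ⨾ push #io true)
writeArcs = push #io false ⨾
  while #d ((pop #d ⨾ push #io false) ⨾ pump #c #b #io ⨾ push #io false ⨾ move #d #io ⨾
    -- Restoring `#c` from `#b` writes the target again, now for the other arc of the pair.
    (pop #d ⨾ push #io true ⨾ push #io false) ⨾ pump #b #c #io ⨾ push #io false ⨾ move #d #io ⨾
    pop #d ⨾ push #io true ⨾ pop #c) ⨾
  -- Now `#c` holds `2 + M`, the index of leaf edge 2, where `M` is the number of edges of the input
  -- graph. The sources `suc M` and `M` come from the same counter by dropping one and then two
  -- ones.
  push #io false ⨾ pump #c #b #io ⨾ (push #io false ⨾ pop #b) ⨾ pump #b #c #io ⨾
  (push #io true ⨾ push #c true ⨾ push #io false) ⨾ pump #c #b #io ⨾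
  (push #io false ⨾ pop #b ⨾ pop #b) ⨾ pump #b #c #io ⨾ push #io true
writePendants = push #io false ⨾
  while #p ((pop #p ⨾ pop #v ⨾ push #u true ⨾ push #io false) ⨾ pump #v #b #io ⨾ move #b #v ⨾
    push #io false ⨾ push #io true)
writeEdges = while #e (pop #e ⨾ transfer #e #io)
-- `writePendants` has left the old vertices counted on `#v` and the leaves on `#u`.
writeVertices = push #io false ⨾ move #u #io ⨾ move #v #io

readAll writeAll main : Prog 10
-- With these two ones `#c` reaches `m + (2 + M)`, the index of the last leaf edge, from which
-- `writeArcs` counts down.
readAll = (push #c true ⨾ push #c true) ⨾ readVertices ⨾ readEdges ⨾ readConstraints
main = readAll ⨾ initialise ⨾ writeAll
writeAll = writeUpper ⨾ writeLower ⨾ writeArcs ⨾ writePendants ⨾ writeEdges ⨾ writeVertices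

iterateℕ-× : {A B : Set} (f : ℕ → A → A) (g : ℕ → B → B) → ∀ k a b →
             iterateℕ (λ n (a , b) → f n a , g n b) k (a , b) ≡ (iterateℕ f k a , iterateℕ g k b)
iterateℕ-× f g zero a b = refl
iterateℕ-× f g (suc k) a b = iterateℕ-× f g k (f k a) (g k b)

iterate-reverse : ∀ {A : Set} (xs : List A) → iterateList (λ _ → _∷_) xs [] ≡ reverse xs
iterate-reverse xs = go xs []
  where
  go : ∀ {A : Set} (xs ys : List A) → iterateList (λ _ → _∷_) xs ys ≡ xs ʳ++ ys
  go [] ys = refl
  go (x ∷ xs) ys = go xs (x ∷ ys)

upperOn lower0On lower1On : List Bool → List Bool
upperOn r = true ∷ true ∷ true ∷ false ∷ r
lower0On r = true ∷ false ∷ r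
lower1On r = true ∷ true ∷ false ∷ r

arcsOn : ℕ → ℕ × ℕ → List Bool → List Bool
arcsOn t (e , f) r = pairOn (e , t) (pairOn (f , t) r)

pendantOn : ℕ → ℕ → List Bool → List Bool
pendantOn n j r = pairOn (0 , j + n) r

constraintsOn : ℕ → List (ℕ × ℕ) → List Bool → List Bool
constraintsOn M = iterateList (λ xs x → arcsOn (suc (length xs) + (2 + M)) x)

ones-+ : ∀ m n r → ones m (ones n r) ≡ ones (m + n) r
ones-+ zero n r = refl
ones-+ (suc m) n r = cong (true ∷_) (ones-+ m n r)

input : ℕ → List (ℕ × ℕ) → List (ℕ × ℕ) → List Bool
input n es ds = ones n (false ∷ pairsOn es (false ∷ pairsOn ds (false ∷ [])))

-- `es` and `ds` stand in the order in which the stacks deliver them, the reverse of the order in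
-- the instance; `iterateList` puts the entry it meets last outermost and so restores the order.
output : ℕ → ℕ → ℕ → List (ℕ × ℕ) → List (ℕ × ℕ) → List Bool
output n m M es ds =
  ones n (ones (3 + m) (false ∷
  iterateList (λ _ → pairOn) es (iterateℕ (pendantOn n) (3 + m) (false ∷
  pairOn (M , 2 + M) (pairOn (suc M , 2 + M) (constraintsOn M ds (false ∷
  iterateℕ (λ _ → lower0On) (2 + M) (iterateℕ (λ _ → lower1On) (1 + m) (false ∷
  iterateℕ (λ _ → upperOn) (3 + (m + M)) (false ∷ []))))))))))

-- Correctness and cost of the subprograms

module _ (L : ℕ) where
  open Timed L

  pump! : ∀ {k} {a b c : Fin k} {P} (st : ℕ → List Bool → List Bool → State k) →
          (∀ x y → top (st 0 x y) a ≢ just true) →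
          (∀ n x y → top (st (suc n) x y) a ≡ just true) →
          (∀ n x y → pop a ⨾ push b true ⨾ push c true ⊢ st (suc n) x y ⇓≤[ P ] st n (true ∷ x) (true ∷ y)) →
          ∀ k x y → k ≤ L → pump a b c ⊢ st k x y ⇓≤[ loopPoly P ] st 0 (ones k x) (ones k y)
  pump! {P = P} st end next body k x y k≤L =
    subst (λ (x′ , y′) → _ ⊢ st k x y ⇓≤[ loopPoly P ] st 0 x′ y′)
      (trans (iterateℕ-× _ _ k x y) (cong₂ _,_ (iterateℕ-true k x) (iterateℕ-true k y)))
      (while-ℕ (λ n (x , y) → st n x y) _ (λ _ → end _ _) (λ _ _ → next _ _ _)
        k (x , y) k≤L (λ _ _ _ → body _ _ _))

  pump-CB : ∀ {a v e u z f w p b} k → k ≤ L →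
    pump #c #b #io ⊢ a ∷ v ∷ e ∷ ones k [] ∷ u ∷ z ∷ f ∷ w ∷ p ∷ b ∷ []
      ⇓≤[ _ ] ones k a ∷ v ∷ e ∷ [] ∷ u ∷ z ∷ f ∷ w ∷ p ∷ ones k b ∷ []
  pump-CB {v = v} {e} {u} {z} {f} {w} {p} k =
    pump! (λ n y x → x ∷ v ∷ e ∷ ones n [] ∷ u ∷ z ∷ f ∷ w ∷ p ∷ y ∷ [])
      (λ _ _ ()) (λ _ _ _ → refl) (λ _ _ _ → ops!) k _ _

  pump-BC : ∀ {a v e c u z f w p} k → k ≤ L →
    pump #b #c #io ⊢ a ∷ v ∷ e ∷ c ∷ u ∷ z ∷ f ∷ w ∷ p ∷ ones k [] ∷ []
      ⇓≤[ _ ] ones k a ∷ v ∷ e ∷ ones k c ∷ u ∷ z ∷ f ∷ w ∷ p ∷ [] ∷ []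
  pump-BC {v = v} {e} {c} {u} {z} {f} {w} {p} k =
    pump! (λ n y x → x ∷ v ∷ e ∷ y ∷ u ∷ z ∷ f ∷ w ∷ p ∷ ones n [] ∷ [])
      (λ _ _ ()) (λ _ _ _ → refl) (λ _ _ _ → ops!) k _ _

  pump-VB : ∀ {a e c u z f w p b} k → k ≤ L →
    pump #v #b #io ⊢ a ∷ ones k [] ∷ e ∷ c ∷ u ∷ z ∷ f ∷ w ∷ p ∷ b ∷ []
      ⇓≤[ _ ] ones k a ∷ [] ∷ e ∷ c ∷ u ∷ z ∷ f ∷ w ∷ p ∷ ones k b ∷ []
  pump-VB {e = e} {c} {u} {z} {f} {w} {p} k =
    pump! (λ n y x → x ∷ ones n [] ∷ e ∷ c ∷ u ∷ z ∷ f ∷ w ∷ p ∷ y ∷ [])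
      (λ _ _ ()) (λ _ _ _ → refl) (λ _ _ _ → ops!) k _ _

  Small : ℕ × ℕ → Set
  Small (i , j) = i ≤ L × j ≤ L

  -- In the invariant the counters grow by the length of the accumulated list, so `iterate-reverse`
  -- settles the stored list and the counters together.
  readEdges! : ∀ {v c u z f w p b} es r → All Small es → length es ≤ L →
    readEdges ⊢ pairsOn es (false ∷ r) ∷ v ∷ [] ∷ c ∷ u ∷ z ∷ f ∷ w ∷ p ∷ b ∷ []
      ⇓≤[ _ ] r ∷ v ∷ stored (reverse es) [] ∷ ones (length es) c ∷ ones (length es) u ∷ ones (length es) z
        ∷ f ∷ w ∷ p ∷ b ∷ []
  readEdges! {v} {c} {u} {z} {f} {w} {p} {b} es r small es≤L =
    subst₂ (λ acc n → readEdges ⊢ S es [] ⇓≤[ _ ] r ∷ v ∷ stored acc [] ∷ ones n c ∷ ones n u ∷ ones n z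
              ∷ f ∷ w ∷ p ∷ b ∷ [])
      (iterate-reverse es) (trans (cong length (iterate-reverse es)) (length-reverse es))
      (while-list S (λ _ → _∷_) Small (λ _ ()) (λ _ _ _ → refl) es [] small es≤L body ▹ ops!)
    where
    S : List (ℕ × ℕ) → List (ℕ × ℕ) → State 10
    S ps acc = pairsOn ps (false ∷ r) ∷ v ∷ stored acc [] ∷ ones n c ∷ ones n u ∷ ones n z ∷ f ∷ w ∷ p ∷ b ∷ []
      where n = length acc
    body : ∀ {p} → Small p → ∀ ps acc → _ → _ ⊢ S (p ∷ ps) acc ⇓≤[ _ ] S ps (p ∷ acc)
    body {i , j} (i≤L , j≤L) ps acc _ =
      ops! ▹ ops! ▹ move! (λ ()) i _ _ i≤L refl (λ ()) ▹ ops! ▹ move! (λ ()) j _ _ j≤L refl (λ ()) ▹ ops!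

  readConstraints! : ∀ {v e c u z w p b} ds r → All Small ds → length ds ≤ L →
    readConstraints ⊢ pairsOn ds (false ∷ r) ∷ v ∷ e ∷ c ∷ u ∷ z ∷ [] ∷ w ∷ p ∷ b ∷ []
      ⇓≤[ _ ] r ∷ ones (length ds) v ∷ e ∷ ones (length ds) c ∷ ones (length ds) u ∷ z
        ∷ stored (reverse ds) [] ∷ ones (length ds) w ∷ ones (length ds) p ∷ b ∷ []
  readConstraints! {v} {e} {c} {u} {z} {w} {p} {b} ds r small ds≤L =
    subst₂ (λ acc n → readConstraints ⊢ S ds [] ⇓≤[ _ ] r ∷ ones n v ∷ e ∷ ones n c ∷ ones n u ∷ z
              ∷ stored acc [] ∷ ones n w ∷ ones n p ∷ b ∷ [])
      (iterate-reverse ds) (trans (cong length (iterate-reverse ds)) (length-reverse ds))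
      (while-list S (λ _ → _∷_) Small (λ _ ()) (λ _ _ _ → refl) ds [] small ds≤L body ▹ ops!)
    where
    S : List (ℕ × ℕ) → List (ℕ × ℕ) → State 10
    S ps acc = pairsOn ps (false ∷ r) ∷ ones n v ∷ e ∷ ones n c ∷ ones n u ∷ z
                 ∷ stored acc [] ∷ ones n w ∷ ones n p ∷ b ∷ []
      where n = length acc
    body : ∀ {p} → Small p → ∀ ps acc → _ → _ ⊢ S (p ∷ ps) acc ⇓≤[ _ ] S ps (p ∷ acc)
    body {i , j} (i≤L , j≤L) ps acc _ =
      ops! ▹ ops! ▹ move! (λ ()) i _ _ i≤L refl (λ ()) ▹ ops! ▹ move! (λ ()) j _ _ j≤L refl (λ ()) ▹ ops!

  writeUpper! : ∀ {a v e c z d w p b} k → k ≤ L →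
    writeUpper ⊢ a ∷ v ∷ e ∷ c ∷ ones k [] ∷ z ∷ d ∷ w ∷ p ∷ b ∷ []
      ⇓≤[ _ ] iterateℕ (λ _ → upperOn) k (false ∷ a) ∷ v ∷ e ∷ c ∷ [] ∷ z ∷ d ∷ w ∷ p ∷ b ∷ []
  writeUpper! {a} {v} {e} {c} {z} {d} {w} {p} {b} k k≤L =
    ops! ▹ while-ℕ (λ n a → a ∷ v ∷ e ∷ c ∷ ones n [] ∷ z ∷ d ∷ w ∷ p ∷ b ∷ [])
             _ (λ _ ()) (λ _ _ → refl) k (false ∷ a) k≤L (λ _ _ _ → ops!)

  writeLower! : ∀ {a v e c u d p b} k l → k ≤ L → l ≤ L →
    writeLower ⊢ a ∷ v ∷ e ∷ c ∷ u ∷ ones k [] ∷ d ∷ ones l [] ∷ p ∷ b ∷ []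
      ⇓≤[ _ ] iterateℕ (λ _ → lower0On) k (iterateℕ (λ _ → lower1On) l (false ∷ a))
                ∷ v ∷ e ∷ c ∷ u ∷ [] ∷ d ∷ [] ∷ p ∷ b ∷ []
  writeLower! {a} {v} {e} {c} {u} {d} {p} {b} k l k≤L l≤L =
    ops! ▹ while-ℕ (λ n a → a ∷ v ∷ e ∷ c ∷ u ∷ ones k [] ∷ d ∷ ones n [] ∷ p ∷ b ∷ [])
             _ (λ _ ()) (λ _ _ → refl) l (false ∷ a) l≤L (λ _ _ _ → ops!)
         ▹ while-ℕ (λ n a → a ∷ v ∷ e ∷ c ∷ u ∷ ones n [] ∷ d ∷ [] ∷ p ∷ b ∷ [])
             _ (λ _ ()) (λ _ _ → refl) k _ k≤L (λ _ _ _ → ops!)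

  writeArcs! : ∀ {a v e u z w p} M ds → All Small ds → 2 + (length ds + M) ≤ L →
    writeArcs ⊢ a ∷ v ∷ e ∷ ones (length ds + (2 + M)) [] ∷ u ∷ z ∷ stored ds [] ∷ w ∷ p ∷ [] ∷ []
      ⇓≤[ _ ] pairOn (M , 2 + M) (pairOn (suc M , 2 + M) (constraintsOn M ds (false ∷ a)))
                ∷ v ∷ e ∷ ones M [] ∷ u ∷ z ∷ [] ∷ w ∷ p ∷ [] ∷ []
  writeArcs! {a} {v} {e} {u} {z} {w} {p} M ds small ≤L =
    ops! ▹ while-list S _ Small (λ _ ()) (λ _ _ _ → refl) ds (false ∷ a) small
             (≤-trans (m≤m+n _ M) (≤-trans (m≤n+m _ 2) ≤L)) body
         ▹ ops! ▹ pump-CB (2 + M) M≤L ▹ ops! ▹ pump-BC (suc M) (<⇒≤ M≤L)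
         ▹ ops! ▹ pump-CB (2 + M) M≤L ▹ ops! ▹ pump-BC M (<⇒≤ (<⇒≤ M≤L)) ▹ ops!
    where
    M≤L : 2 + M ≤ L
    M≤L = ≤-trans (+-monoʳ-≤ 2 (m≤n+m M _)) ≤L
    S : List (ℕ × ℕ) → List Bool → State 10
    S ps a = a ∷ v ∷ e ∷ ones (length ps + (2 + M)) [] ∷ u ∷ z ∷ stored ps [] ∷ w ∷ p ∷ [] ∷ []
    body : ∀ {p} → Small p → ∀ ps a → length ps < length ds →
           _ ⊢ S (p ∷ ps) a ⇓≤[ _ ] S ps (arcsOn (suc (length ps) + (2 + M)) p a)
    body {i , j} (i≤L , j≤L) ps a ps<ds =
      ops! ▹ pump-CB k k≤L ▹ ops! ▹ move! (λ ()) j _ _ j≤L refl (λ ()) ▹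
      ops! ▹ pump-BC k k≤L ▹ ops! ▹ move! (λ ()) i _ _ i≤L refl (λ ()) ▹ ops!
      where
      k = suc (length ps) + (2 + M)
      k≤L : k ≤ L
      k≤L = begin
        suc (length ps) + (2 + M) ≤⟨ +-monoˡ-≤ (2 + M) ps<ds ⟩
        length ds + (2 + M)       ≡⟨ trans (+-suc (length ds) (suc M)) (cong suc (+-suc (length ds) M)) ⟩
        2 + (length ds + M)       ≤⟨ ≤L ⟩
        L                         ∎
        where open ≤-Reasoning

  writePendants! : ∀ {a e c z d w} n k → k + n ≤ L →
    writePendants ⊢ a ∷ ones (k + n) [] ∷ e ∷ c ∷ [] ∷ z ∷ d ∷ w ∷ ones k [] ∷ [] ∷ []
      ⇓≤[ _ ] iterateℕ (pendantOn n) k (false ∷ a) ∷ ones n [] ∷ e ∷ c ∷ ones k [] ∷ z ∷ d ∷ w ∷ [] ∷ [] ∷ []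
  writePendants! {a} {e} {c} {z} {d} {w} n k ≤L =
    subst (λ x → writePendants ⊢ a ∷ ones (k + n) [] ∷ e ∷ c ∷ [] ∷ z ∷ d ∷ w ∷ ones k [] ∷ [] ∷ [] ⇓≤[ _ ] S 0 x)
      (trans (iterateℕ-× (pendantOn n) (λ _ → true ∷_) k (false ∷ a) [])
        (cong (iterateℕ (pendantOn n) k (false ∷ a) ,_) (iterateℕ-true k [])))
      (ops! ▹ while-ℕ S _ (λ _ ()) (λ _ _ → refl) k (false ∷ a , []) (≤-trans (m≤m+n k n) ≤L) body)
    where
    S : ℕ → List Bool × List Bool → State 10
    S j (a , u) = a ∷ ones (j + n) [] ∷ e ∷ c ∷ u ∷ z ∷ d ∷ w ∷ ones j [] ∷ [] ∷ []
    body : ∀ j x → j < k → _ ⊢ S (suc j) x ⇓≤[ _ ] S j (pendantOn n j (proj₁ x) , true ∷ proj₂ x)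
    body j _ j<k =
      ops! ▹ pump-VB (j + n) j+n≤L ▹ move! (λ ()) (j + n) _ _ j+n≤L refl (λ ()) ▹ ops!
      where
      j+n≤L : j + n ≤ L
      j+n≤L = ≤-trans (+-monoˡ-≤ n (<⇒≤ j<k)) ≤L

  writeEdges! : ∀ {a v c u z d w p b} es → All Small es → length es ≤ L →
    writeEdges ⊢ a ∷ v ∷ stored es [] ∷ c ∷ u ∷ z ∷ d ∷ w ∷ p ∷ b ∷ []
      ⇓≤[ _ ] iterateList (λ _ → pairOn) es a ∷ v ∷ [] ∷ c ∷ u ∷ z ∷ d ∷ w ∷ p ∷ b ∷ []
  writeEdges! {a} {v} {c} {u} {z} {d} {w} {p} {b} es small ≤L =
    while-list S _ Small (λ _ ()) (λ _ _ _ → refl) es a small ≤L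
      (λ { {i , j} (i≤L , j≤L) ps a _ → ops! ▹ ops! ▹ move! (λ ()) j _ _ j≤L refl (λ ()) ▹
           ops! ▹ move! (λ ()) i _ _ i≤L refl (λ ()) ▹ ops! })
    where
    S : List (ℕ × ℕ) → List Bool → State 10
    S ps a = a ∷ v ∷ stored ps [] ∷ c ∷ u ∷ z ∷ d ∷ w ∷ p ∷ b ∷ []

  writeVertices! : ∀ {a e c z d w p b} n k → n ≤ L → k ≤ L →
    writeVertices ⊢ a ∷ ones n [] ∷ e ∷ c ∷ ones k [] ∷ z ∷ d ∷ w ∷ p ∷ b ∷ []
      ⇓≤[ _ ] ones n (ones k (false ∷ a)) ∷ [] ∷ e ∷ c ∷ [] ∷ z ∷ d ∷ w ∷ p ∷ b ∷ []
  writeVertices! n k n≤L k≤L =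
    ops! ▹ move! (λ ()) k [] _ k≤L refl (λ ()) ▹ move! (λ ()) n [] _ n≤L refl (λ ())

  readAll! : ∀ n es ds → All Small es → All Small ds → n ≤ L → length es ≤ L → length ds ≤ L →
    readAll ⊢ input n es ds ∷ Vec.replicate 9 []
      ⇓≤[ _ ] [] ∷ ones (length ds) (ones n []) ∷ stored (reverse es) []
        ∷ ones (length ds) (ones (length es) (true ∷ true ∷ [])) ∷ ones (length ds) (ones (length es) [])
        ∷ ones (length es) [] ∷ stored (reverse ds) [] ∷ ones (length ds) [] ∷ ones (length ds) [] ∷ [] ∷ []
  readAll! n es ds smallEs smallDs n≤L es≤L ds≤L =
    ops! ▹ (move! (λ ()) n _ _ n≤L refl (λ ()) ▹ ops!) ▹
    readEdges! es _ smallEs es≤L ▹ readConstraints! ds _ smallDs ds≤L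

  initialise! : ∀ {a v e c u z d w p b} →
    initialise ⊢ a ∷ v ∷ e ∷ c ∷ u ∷ z ∷ d ∷ w ∷ p ∷ b ∷ []
      ⇓≤[ _ ] a ∷ ones 3 v ∷ e ∷ c ∷ ones 3 u ∷ ones 2 z ∷ d ∷ ones 1 w ∷ ones 3 p ∷ b ∷ []
  initialise! = ops!

module _ (L : ℕ) where
  open Timed L

  writeAll! : ∀ n m M es ds → All (Small L) es → All (Small L) ds → length es ≡ M → length ds ≡ m →
    3 + (m + n) ≤ L → 3 + (m + M) ≤ L →
    writeAll ⊢ [] ∷ ones (3 + m + n) [] ∷ stored es [] ∷ ones (m + (2 + M)) []
        ∷ ones (3 + (m + M)) [] ∷ ones (2 + M) [] ∷ stored ds [] ∷ ones (1 + m) []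
        ∷ ones (3 + m) [] ∷ [] ∷ []
      ⇓≤[ _ ] output n m M es ds ∷ [] ∷ [] ∷ ones M [] ∷ Vec.replicate 6 []
  writeAll! n m M es ds smallEs smallDs refl refl n≤ M≤ =
    writeUpper! L _ M≤ ▹
    writeLower! L (2 + M) (1 + m) (≤-trans (+-monoʳ-≤ 2 (m≤n+m M (1 + m))) M≤)
      (≤-trans (+-monoʳ-≤ 1 (≤-trans (m≤m+n m M) (m≤n+m _ 2))) M≤) ▹
    writeArcs! L M ds smallDs (<⇒≤ M≤) ▹
    writePendants! L n (3 + m) n≤ ▹
    writeEdges! L es smallEs (≤-trans (m≤n+m M (3 + m)) M≤) ▹
    writeVertices! L n (3 + m) (≤-trans (m≤n+m n (3 + m)) n≤) (≤-trans (+-monoʳ-≤ 3 (m≤m+n m n)) n≤)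

  -- Reading stacks one length on top of another, so the counters arrive as nested `ones`; the
  -- writing phase wants each as a single number.
  initial-counters : ∀ m n M →
    _≡_ {A = List Bool × List Bool × List Bool × List Bool}
      (ones 3 (ones m (ones n [])) , ones m (ones M (true ∷ true ∷ [])) , ones 3 (ones m (ones M [])) , ones 2 (ones M []))
      (ones (3 + m + n) [] , ones (m + (2 + M)) [] , ones (3 + (m + M)) [] , ones (2 + M) [])
  initial-counters m n M =
    cong₂ _,_ (ones-+ (3 + m) n []) (cong₂ _,_
      (trans (cong (ones m) (trans (ones-suc M _) (cong (true ∷_) (ones-suc M _)))) (ones-+ m (2 + M) []))
      (cong₂ _,_ (ones-+ (3 + m) M []) refl))

  main! : ∀ n m M es ds → length es ≡ M → length ds ≡ m → All (Small L) es → All (Small L) ds →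
    3 + (m + n) ≤ L → 3 + (m + M) ≤ L →
    main ⊢ input n es ds ∷ Vec.replicate 9 []
      ⇓≤[ _ ] output n m M (reverse es) (reverse ds) ∷ [] ∷ [] ∷ ones M [] ∷ Vec.replicate 6 []
  main! n m M es ds refl refl smallEs smallDs n≤ M≤ =
    readAll! L n es ds smallEs smallDs
      (≤-trans (m≤n+m n (3 + m)) n≤) (≤-trans (m≤n+m M (3 + m)) M≤) (≤-trans (m≤m+n m M) (≤-trans (m≤n+m _ 3) M≤)) ▹
    initialise! L ▹
    from-≡
      (cong (λ (v , c , u , z) → [] ∷ v ∷ stored (reverse es) [] ∷ c ∷ u ∷ z ∷ stored (reverse ds) []
                                   ∷ ones (1 + m) [] ∷ ones (3 + m) [] ∷ [] ∷ [])
        (sym (initial-counters m n M)))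
      (writeAll! n m M (reverse es) (reverse ds)
        (All-resp-↭ (↭-sym (↭-reverse es)) smallEs) (All-resp-↭ (↭-sym (↭-reverse ds)) smallDs)
        (length-reverse es) (length-reverse ds) n≤ M≤)

-- Attaching leaves

data Split (m {n} : ℕ) : Fin (m + n) → Set where
  old : ∀ i → Split m (i ↑ˡ n)
  new : ∀ j → Split m (m ↑ʳ j)

split : ∀ m {n} (i : Fin (m + n)) → Split m i
split m {n} i = subst (Split m) (join-splitAt m n i) (view (splitAt m i))
  where
  view : ∀ x → Split m (join m n x)
  view (inj₁ i) = old i
  view (inj₂ j) = new j

↑ˡ≢↑ʳ : ∀ {m n} (i : Fin m) (j : Fin n) → i ↑ˡ n ≢ m ↑ʳ j
↑ˡ≢↑ʳ {m} {n} i j eq with () ← trans (sym (splitAt-↑ˡ m i n)) (trans (cong (splitAt m) eq) (splitAt-↑ʳ m n j))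

Adjacent-sym : ∀ {n} (G : Graph n) H {v w} → Adjacent G H v w → Adjacent G H w v
Adjacent-sym _ _ (e , e∈H , v-w) = e , e∈H , Sum.swap v-w

module Pendants {n : ℕ} (G : Graph (suc n)) (K : ℕ) where

  N = suc n + K
  M = size G

  ι : Fin (suc n) → Fin N
  ι = _↑ˡ K

  leaf : Fin K → Fin N
  leaf = suc n ↑ʳ_

  pendantEnds : Fin M ⊎ Fin K → Fin N × Fin N
  pendantEnds = [ Product.map ι ι ∘ ends G , (λ j → zero , leaf j) ]′

  ends⁺ : Fin (M + K) → Fin N × Fin N
  ends⁺ e = pendantEnds (splitAt M e)

  ends⁺-old : ∀ e → ends⁺ (e ↑ˡ K) ≡ Product.map ι ι (ends G e)
  ends⁺-old e = cong pendantEnds (splitAt-↑ˡ M e K)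

  ends⁺-new : ∀ j → ends⁺ (M ↑ʳ j) ≡ (zero , leaf j)
  ends⁺-new j = cong pendantEnds (splitAt-↑ʳ M K j)

  G⁺ : Graph N
  G⁺ = record { size = M + K ; ends = ends⁺ ; ordered = ordered⁺ ; simple = simple⁺ }
    where
    ordered⁺ : ∀ e → toℕ (proj₁ (ends⁺ e)) < toℕ (proj₂ (ends⁺ e))
    ordered⁺ e with split M e
    ... | old e rewrite ends⁺-old e | toℕ-↑ˡ (proj₁ (ends G e)) K | toℕ-↑ˡ (proj₂ (ends G e)) K = ordered G e
    ... | new j rewrite ends⁺-new j = z<s
    simple⁺ : ∀ {e f} → ends⁺ e ≡ ends⁺ f → e ≡ f
    simple⁺ {e} {f} eq with split M e | split M f
    ... | old e | old f = cong (_↑ˡ K) (simple G (cong₂ _,_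
      (↑ˡ-injective K _ _ (,-injectiveˡ eq′)) (↑ˡ-injective K _ _ (,-injectiveʳ eq′))))
      where eq′ = trans (sym (ends⁺-old e)) (trans eq (ends⁺-old f))
    ... | old e | new j = contradiction (,-injectiveʳ (trans (sym (ends⁺-old e)) (trans eq (ends⁺-new j)))) (↑ˡ≢↑ʳ _ _)
    ... | new j | old f = contradiction (,-injectiveʳ (trans (sym (ends⁺-old f)) (trans (sym eq) (ends⁺-new j)))) (↑ˡ≢↑ʳ _ _)
    ... | new i | new j = cong (M ↑ʳ_) (↑ʳ-injective (suc n) i j
      (,-injectiveʳ (trans (sym (ends⁺-new i)) (trans eq (ends⁺-new j)))))

  -- `T` and `T⁺` are related only by agreeing on the old edges, so the same lemmas serve for
  -- extending a given `T` and for restricting a given `T⁺`.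
  module _ (T : Subset M) (T⁺ : Subset (M + K))
           (embed : ∀ {e} → e ∈ T → e ↑ˡ K ∈ T⁺) (restrict′ : ∀ {e} → e ↑ˡ K ∈ T⁺ → e ∈ T) where

    private
      _~_ = Adjacent G T
      _~⁺_ = Adjacent G⁺ T⁺

    data Step : Fin N → Fin N → Set where
      inner : ∀ {v w} → v ~ w → Step (ι v) (ι w)
      to    : ∀ {j} → M ↑ʳ j ∈ T⁺ → Step zero (leaf j)
      from  : ∀ {j} → M ↑ʳ j ∈ T⁺ → Step (leaf j) zero

    step : ∀ {x y} → x ~⁺ y → Step x y
    step (e , e∈ , x-y) with split M e
    step (_ , e∈ , inj₁ x-y) | old e rewrite ends⁺-old e with refl ← x-y = inner (e , restrict′ e∈ , inj₁ refl)
    step (_ , e∈ , inj₂ x-y) | old e rewrite ends⁺-old e with refl ← x-y = inner (e , restrict′ e∈ , inj₂ refl)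
    step (_ , e∈ , inj₁ x-y) | new j rewrite ends⁺-new j with refl ← x-y = to e∈
    step (_ , e∈ , inj₂ x-y) | new j rewrite ends⁺-new j with refl ← x-y = from e∈

    ~⇒~⁺ : ∀ {v w} → v ~ w → ι v ~⁺ ι w
    ~⇒~⁺ (e , e∈ , v-w) = e ↑ˡ K , embed e∈ , Sum.map old-ends old-ends v-w
      where
      old-ends : ∀ {p} → ends G e ≡ p → ends⁺ (e ↑ˡ K) ≡ Product.map ι ι p
      old-ends eq = trans (ends⁺-old e) (cong (Product.map ι ι) eq)

    ~⁺⇒~ : ∀ {v w} → ι v ~⁺ ι w → v ~ w
    ~⁺⇒~ = go refl refl ∘ step
      where
      -- The endpoints are generalised up to equations because the indices `ι v` and `ι w` would
      -- block matching on `Step`.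
      go : ∀ {x y v w} → x ≡ ι v → y ≡ ι w → Step x y → v ~ w
      go p q (inner v~w) = subst₂ _~_ (↑ˡ-injective K _ _ p) (↑ˡ-injective K _ _ q) v~w
      go p q (to _) = contradiction (sym q) (↑ˡ≢↑ʳ _ _)
      go p q (from _) = contradiction (sym p) (↑ˡ≢↑ʳ _ _)

    -- The first step of any path from a leaf to vertex 0 can only be along the edge of that leaf.
    leaf-used : (∀ v w → Star _~⁺_ v w) → ∀ j → M ↑ʳ j ∈ T⁺
    leaf-used conn j = go refl (conn (leaf j) zero)
      where
      go : ∀ {x} → x ≡ leaf j → Star _~⁺_ x zero → M ↑ʳ j ∈ T⁺
      go () ε
      go p (s ◅ _) with step s
      ... | inner _ = contradiction p (↑ˡ≢↑ʳ _ _)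
      ... | from {i} i∈ = subst (λ i → M ↑ʳ i ∈ T⁺) (↑ʳ-injective (suc n) i j p) i∈

    Connected⁺ : (∀ j → M ↑ʳ j ∈ T⁺) → Connected G T → Connected G⁺ T⁺
    Connected⁺ leaves (_ , conn) = _ , λ x y → Star.reverse (Adjacent-sym G⁺ T⁺) (from-0 x) ◅◅ from-0 y
      where
      from-0 : ∀ x → Star _~⁺_ zero x
      from-0 x with split (suc n) x
      ... | old v = Star.gmap ι ~⇒~⁺ (conn zero v)
      ... | new j = (M ↑ʳ j , leaves j , inj₁ (ends⁺-new j)) ◅ ε

    -- The map `ρ` contracts all leaves into vertex 0: an old edge is kept and a leaf edge collapses
    -- to the empty path.
    Connected⁻ : Connected G⁺ T⁺ → Connected G T
    Connected⁻ (_ , conn) = _ , λ v w → subst₂ (Star _~_) (ρ-ι v) (ρ-ι w) (Star.kleisliStar ρ ρ-step (conn (ι v) (ι w)))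
      where
      ρ : Fin N → Fin (suc n)
      ρ x = [ (λ v → v) , (λ _ → zero) ]′ (splitAt (suc n) x)
      ρ-ι : ∀ v → ρ (ι v) ≡ v
      ρ-ι v = cong [ _ , _ ]′ (splitAt-↑ˡ (suc n) v K)
      ρ-leaf : ∀ j → ρ (leaf j) ≡ zero
      ρ-leaf j = cong [ _ , _ ]′ (splitAt-↑ʳ (suc n) K j)
      ρ-step : ∀ {x y} → x ~⁺ y → Star _~_ (ρ x) (ρ y)
      ρ-step s with step s
      ... | inner {v} {w} v~w = subst₂ (Star _~_) (sym (ρ-ι v)) (sym (ρ-ι w)) (v~w ◅ ε)
      ... | to {j} _ = subst (Star _~_ zero) (sym (ρ-leaf j)) ε
      ... | from {j} _ = subst (λ x → Star _~_ x zero) (sym (ρ-leaf j)) ε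

    Acyclic⁻ : Acyclic G⁺ T⁺ → Acyclic G T
    Acyclic⁻ acyclic v ws (2≤ , uniq , link) = acyclic (ι v) (map ι ws)
      ( subst (2 ≤_) (sym (length-map ι ws)) 2≤
      , Uniqueₚ.map⁺ (↑ˡ-injective K _ _) uniq
      , subst (Linked _~⁺_) (map-++ ι (v ∷ ws) (v ∷ [])) (Linkedₚ.map⁺ (Linked.map ~⇒~⁺ link)) )

    IsLeaf : Fin N → Set
    IsLeaf x = ∃[ j ] x ≡ leaf j

    before-leaf : ∀ {x y} → x ~⁺ y → IsLeaf y → x ≡ zero
    before-leaf s (j , p) with step s
    ... | inner _ = contradiction p (↑ˡ≢↑ʳ _ _)
    ... | to _ = refl

    after-leaf : ∀ {x y} → x ~⁺ y → IsLeaf x → y ≡ zero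
    after-leaf s = before-leaf (Adjacent-sym G⁺ T⁺ s)

    -- A leaf inside the path would have vertex 0 both before and after it, contradicting
    -- distinctness. The disjunction is for the closed path `a = z`, where a single inner vertex
    -- would have equal neighbours; after one step the new start differs from `z`.
    inner-vertices : ∀ a xs z → Linked _~⁺_ (a ∷ (xs ∷ʳ z)) → Unique (a ∷ xs) → All (z ≢_) xs →
                     (2 ≤ length xs ⊎ a ≢ z) → All (¬_ ∘ IsLeaf) xs
    inner-vertices a [] z _ _ _ _ = []
    inner-vertices a (b ∷ []) z (a~b ∷ b~z ∷ _) _ _ (inj₁ (s≤s ()))
    inner-vertices a (b ∷ []) z (a~b ∷ b~z ∷ _) _ _ (inj₂ a≢z) =
      (λ l → a≢z (trans (before-leaf a~b l) (sym (after-leaf b~z l)))) ∷ []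
    inner-vertices a (b ∷ c ∷ xs) z (a~b ∷ b~c ∷ link) ((_ ∷ a≢c ∷ _) ∷ uniq) (z≢b ∷ z≢) _ =
      (λ l → a≢c (trans (before-leaf a~b l) (sym (after-leaf b~c l)))) ∷
      inner-vertices b (c ∷ xs) z (b~c ∷ link) uniq z≢ (inj₂ (z≢b ∘ sym))

    -- Serves for the base vertex of a cycle, which is not inner: if it is a leaf, vertex 0 is both
    -- its successor and, by this lemma, a later vertex.
    0∈path-to-leaf : ∀ b xs {z} → Linked _~⁺_ (b ∷ (xs ∷ʳ z)) → IsLeaf z → zero ∈ₗ (b ∷ xs)
    0∈path-to-leaf b [] (b~z ∷ _) l = here (sym (before-leaf b~z l))
    0∈path-to-leaf b (c ∷ xs) (_ ∷ link) l = there (0∈path-to-leaf c xs link l)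

    -- Every vertex of a cycle has two distinct neighbours on it, a leaf has only one.
    cycle-avoids-leaves : ∀ v ws → IsCycle G⁺ T⁺ v ws → All (¬_ ∘ IsLeaf) (v ∷ ws)
    cycle-avoids-leaves v (a ∷ b ∷ ws) (2≤ , uniq@(v≢ ∷ a≢ ∷ _) , link@(v~a ∷ _ ∷ link′)) =
      (λ l → All.lookup a≢ (0∈path-to-leaf b ws link′ l) (after-leaf v~a l)) ∷
      inner-vertices v (a ∷ b ∷ ws) v link uniq v≢ (inj₁ 2≤)
    cycle-avoids-leaves v [] (() , _)
    cycle-avoids-leaves v (_ ∷ []) (s≤s () , _)

    not-leaf : ∀ {x} → ¬ IsLeaf x → ∃[ v ] x ≡ ι v
    not-leaf {x} ¬l with split (suc n) x
    ... | old v = v , refl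
    ... | new j = contradiction (j , refl) ¬l

    not-leaves : ∀ {xs} → All (¬_ ∘ IsLeaf) xs → ∃[ vs ] xs ≡ map ι vs
    not-leaves [] = [] , refl
    not-leaves (¬l ∷ ¬ls) with not-leaf ¬l | not-leaves ¬ls
    ... | v , refl | vs , refl = v ∷ vs , refl

    -- A cycle that avoids the leaves is the image under `ι` of a cycle in `G`.
    Acyclic⁺ : Acyclic G T → Acyclic G⁺ T⁺
    Acyclic⁺ acyclic x xs cyc with cycle-avoids-leaves x xs cyc
    ... | ¬l ∷ ¬ls with not-leaf ¬l | not-leaves ¬ls
    ... | v , refl | ws , refl with cyc
    ... | 2≤ , uniq , link = acyclic v ws
      ( subst (2 ≤_) (length-map ι ws) 2≤
      , Uniqueₚ.map⁻ uniq
      , Linked.map ~⁺⇒~ (Linkedₚ.map⁻ (subst (Linked _~⁺_) (sym (map-++ ι (v ∷ ws) (v ∷ []))) link)) )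

-- The instance of G-DCST*

∣p∪q∣≤∣p∣+∣q∣ : ∀ {n} (p q : Subset n) → ∣ p ∪ q ∣ ≤ ∣ p ∣ + ∣ q ∣
∣p∪q∣≤∣p∣+∣q∣ [] [] = z≤n
∣p∪q∣≤∣p∣+∣q∣ (outside ∷ p) (outside ∷ q) = ∣p∪q∣≤∣p∣+∣q∣ p q
∣p∪q∣≤∣p∣+∣q∣ (outside ∷ p) (inside ∷ q) = ≤-trans (s≤s (∣p∪q∣≤∣p∣+∣q∣ p q)) (≤-reflexive (sym (+-suc ∣ p ∣ ∣ q ∣)))
∣p∪q∣≤∣p∣+∣q∣ (inside ∷ p) (outside ∷ q) = s≤s (∣p∪q∣≤∣p∣+∣q∣ p q)
∣p∪q∣≤∣p∣+∣q∣ (inside ∷ p) (inside ∷ q) =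
  s≤s (≤-trans (∣p∪q∣≤∣p∣+∣q∣ p q) (+-monoʳ-≤ ∣ p ∣ (n≤1+n ∣ q ∣)))

∣pair∣≤2 : ∀ {n} (x y : Fin n) → ∣ ⁅ x ⁆ ∪ ⁅ y ⁆ ∣ ≤ 2
∣pair∣≤2 x y = ≤-trans (∣p∪q∣≤∣p∣+∣q∣ ⁅ x ⁆ ⁅ y ⁆) (≤-reflexive (cong₂ _+_ (∣⁅x⁆∣≡1 x) (∣⁅x⁆∣≡1 y)))

2≤∣pair∣ : ∀ {n} {x y : Fin n} → x ≢ y → 2 ≤ ∣ ⁅ x ⁆ ∪ ⁅ y ⁆ ∣
2≤∣pair∣ {x = x} {y} x≢y = subst (λ k → suc k ≤ ∣ ⁅ x ⁆ ∪ ⁅ y ⁆ ∣) (∣⁅x⁆∣≡1 x)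
  (p⊂q⇒∣p∣<∣q∣ (p⊆p∪q ⁅ y ⁆ , y , q⊆p∪q ⁅ x ⁆ ⁅ y ⁆ (x∈⁅x⁆ y) , x≢y ∘ sym ∘ x∈⁅y⁆⇒x≡y x))

∈-pair⁺ : ∀ {n} {x y z : Fin n} → z ≡ x ⊎ z ≡ y → z ∈ ⁅ x ⁆ ∪ ⁅ y ⁆
∈-pair⁺ = x∈p∪q⁺ ∘ Sum.map (λ { refl → x∈⁅x⁆ _ }) (λ { refl → x∈⁅x⁆ _ })

∈-pair⁻ : ∀ {n} {x y z : Fin n} → z ∈ ⁅ x ⁆ ∪ ⁅ y ⁆ → z ≡ x ⊎ z ≡ y
∈-pair⁻ = Sum.map (x∈⁅y⁆⇒x≡y _) (x∈⁅y⁆⇒x≡y _) ∘ x∈p∪q⁻ _ _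

nonempty⇒1≤∣p∣ : ∀ {n} {p : Subset n} → Nonempty p → 1 ≤ ∣ p ∣
nonempty⇒1≤∣p∣ {p = p} (x , x∈p) = subst (_≤ ∣ p ∣) (∣⁅x⁆∣≡1 x) (p⊆q⇒∣p∣≤∣q∣ λ y∈ → subst (_∈ p) (sym (x∈⁅y⁆⇒x≡y x y∈)) x∈p)

1≤∣p∣⇒nonempty : ∀ {n} {p : Subset n} → 1 ≤ ∣ p ∣ → Nonempty p
1≤∣p∣⇒nonempty {n} {p} 1≤ with nonempty? p
... | yes x∈p = x∈p
... | no empty with () ← subst (1 ≤_) (trans (cong ∣_∣ (Empty-unique empty)) (∣⊥∣≡0 n)) 1≤

∈-tabulate-does⁺ : ∀ {n} {A : Fin n → Set} (A? : ∀ x → Dec (A x)) {x} → A x → x ∈ Vec.tabulate (does ∘ A?)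
∈-tabulate-does⁺ A? {x} a = lookup⇒[]= x _ (trans (lookup∘tabulate (does ∘ A?) x) (dec-true (A? x) a))

∈-tabulate-does⁻ : ∀ {n} {A : Fin n → Set} (A? : ∀ x → Dec (A x)) {x} → x ∈ Vec.tabulate (does ∘ A?) → A x
∈-tabulate-does⁻ A? {x} x∈ with A? x | trans (sym (lookup∘tabulate (does ∘ A?) x)) ([]=⇒lookup x∈)
... | yes a | _ = a
... | no _  | ()

module _ {n} (D : Digraph n) where
  open DecMembership (≡-dec (_≟_ {n}) (_≟_ {n})) using (_∈?_)

  ∈-dep⁺ : ∀ {e e′} → (e′ , e) ∈ₗ arcs D → e′ ∈ dep D e
  ∈-dep⁺ {e} = ∈-tabulate-does⁺ (λ e′ → (e′ , e) ∈? arcs D)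

  ∈-dep⁻ : ∀ {e e′} → e′ ∈ dep D e → (e′ , e) ∈ₗ arcs D
  ∈-dep⁻ {e} = ∈-tabulate-does⁻ (λ e′ → (e′ , e) ∈? arcs D)

-- The dependency digraph and the equivalence of the two instances

module Constraints {n : ℕ} (G : Graph (suc n)) (D : Graph (size G)) where

  m = size D

  open Pendants G (3 + m) public

  -- Index `zero` belongs to leaf edge 2, which secures the in-degree, and `suc d` to the `d`-th
  -- edge of `D`.
  pair : Fin (suc m) → Fin (M + (3 + m)) × Fin (M + (3 + m))
  pair zero = M ↑ʳ 0F , M ↑ʳ 1F
  pair (suc d) = proj₁ (ends D d) ↑ˡ (3 + m) , proj₂ (ends D d) ↑ˡ (3 + m)

  target : Fin (suc m) → Fin (M + (3 + m))
  target i = M ↑ʳ suc (suc i)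

  pair-distinct : ∀ i → proj₁ (pair i) ≢ proj₂ (pair i)
  pair-distinct zero eq with () ← ↑ʳ-injective M _ _ eq
  pair-distinct (suc d) eq = <⇒≢ (ordered D d) (↑ˡ-injective (3 + m) _ _ eq)

  pair≢target : ∀ i j → proj₁ (pair i) ≢ target j × proj₂ (pair i) ≢ target j
  pair≢target zero j = (λ eq → case₀ (↑ʳ-injective M _ _ eq)) , (λ eq → case₁ (↑ʳ-injective M _ _ eq))
    where
    case₀ : 0F ≢ suc (suc j)
    case₀ ()
    case₁ : 1F ≢ suc (suc j)
    case₁ ()
  pair≢target (suc d) j = ↑ˡ≢↑ʳ _ _ , ↑ˡ≢↑ʳ _ _

  target-injective : ∀ {i j} → target i ≡ target j → i ≡ j
  target-injective eq = suc-injective (suc-injective (↑ʳ-injective M _ _ eq))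

  arcsTo : Fin (suc m) → List (Edge G⁺ × Edge G⁺)
  arcsTo i = (proj₁ (pair i) , target i) ∷ (proj₂ (pair i) , target i) ∷ []

  ∈-arcsTo : ∀ {i a e} → (a , e) ∈ₗ arcsTo i → e ≡ target i × (a ≡ proj₁ (pair i) ⊎ a ≡ proj₂ (pair i))
  ∈-arcsTo (here refl) = refl , inj₁ refl
  ∈-arcsTo (there (here refl)) = refl , inj₂ refl

  D⁺ : Digraph (M + (3 + m))
  D⁺ = record
    { arcs = concat (tabulate arcsTo)
    ; loopless = Allₚ.concat⁺ (Allₚ.tabulate⁺ λ i → proj₁ (pair≢target i i) ∷ proj₂ (pair≢target i i) ∷ [])
    -- Arcs from different lists differ in their targets.
    ; unique = Uniqueₚ.concat⁺ (Allₚ.tabulate⁺ arcsTo-unique)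
        (AllPairsₚ.tabulate⁺ {f = arcsTo} λ i≢j (∈i , ∈j) →
          i≢j (target-injective (trans (sym (proj₁ (∈-arcsTo ∈i))) (proj₁ (∈-arcsTo ∈j)))))
    }
    where
    arcsTo-unique : ∀ i → Unique (arcsTo i)
    arcsTo-unique i = ((λ eq → pair-distinct i (cong proj₁ eq)) ∷ []) ∷ [] ∷ []

  ∈-dep-target : ∀ i {a} → a ≡ proj₁ (pair i) ⊎ a ≡ proj₂ (pair i) → a ∈ dep D⁺ (target i)
  ∈-dep-target i a≡ = ∈-dep⁺ D⁺ (∈-concat⁺′ (∈arcs a≡) (∈-tabulate⁺ {f = arcsTo} i))
    where
    ∈arcs : ∀ {a} → a ≡ proj₁ (pair i) ⊎ a ≡ proj₂ (pair i) → (a , target i) ∈ₗ arcsTo i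
    ∈arcs (inj₁ refl) = here refl
    ∈arcs (inj₂ refl) = there (here refl)

  ∈-dep : ∀ {e a} → a ∈ dep D⁺ e → ∃[ i ] (e ≡ target i × (a ≡ proj₁ (pair i) ⊎ a ≡ proj₂ (pair i)))
  ∈-dep a∈ with ∈-concat⁻′ (tabulate arcsTo) (∈-dep⁻ D⁺ a∈)
  ... | _ , a∈i , i∈ with ∈-tabulate⁻ {f = arcsTo} i∈
  ... | i , refl = i , ∈-arcsTo a∈i

  -- By injectivity of `target` all arcs into an edge come from one pair. This also yields the upper
  -- bound 2 for every subgraph.
  inDegree≤2 : ∀ e → inDegree D⁺ e ≤ 2
  inDegree≤2 e with nonempty? (dep D⁺ e)
  ... | no empty = ≤-trans (≤-reflexive (trans (cong ∣_∣ (Empty-unique empty)) (∣⊥∣≡0 (M + (3 + m))))) z≤n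
  ... | yes (_ , a∈) with ∈-dep a∈
  ... | i , refl , _ = ≤-trans (p⊆q⇒∣p∣≤∣q∣ within) (∣pair∣≤2 (proj₁ (pair i)) (proj₂ (pair i)))
    where
    within : dep D⁺ (target i) ⊆ ⁅ proj₁ (pair i) ⁆ ∪ ⁅ proj₂ (pair i) ⁆
    within b∈ with ∈-dep b∈
    ... | j , ti≡tj , b≡ with refl ← target-injective {i} {j} ti≡tj = ∈-pair⁺ b≡

  2≤inDegree : ∀ i → 2 ≤ inDegree D⁺ (target i)
  2≤inDegree i = ≤-trans (2≤∣pair∣ (pair-distinct i)) (p⊆q⇒∣p∣≤∣q∣ (∈-dep-target i ∘ ∈-pair⁻))

  maxInDegree≡2 : maxInDegree D⁺ ≡ 2
  maxInDegree≡2 = ≤-antisym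
    (max≤v⁺ z≤n (Allₚ.map⁺ {xs = allFin _} (All.tabulate λ {e} _ → inDegree≤2 e)))
    (v≤max⁺ 0 _ (inj₂ (Any.map (λ { refl → 2≤inDegree 0F }) (∈-map⁺ (inDegree D⁺) (∈-allFin (target 0F))))))

  leafLower : Fin (3 + m) → ℕ
  leafLower 0F = 0
  leafLower 1F = 0
  leafLower (suc (suc _)) = 1

  lower : Edge G⁺ → ℕ
  lower e = [ (λ _ → 0) , leafLower ]′ (splitAt M e)

  lower-old : ∀ e → lower (e ↑ˡ (3 + m)) ≡ 0
  lower-old e = cong [ _ , _ ]′ (splitAt-↑ˡ M e (3 + m))

  lower-new : ∀ j → lower (M ↑ʳ j) ≡ leafLower j
  lower-new j = cong [ _ , _ ]′ (splitAt-↑ʳ M (3 + m) j)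

  lower∈01 : ∀ e → lower e ≡ 0 ⊎ lower e ≡ 1
  lower∈01 e with splitAt M e
  ... | inj₁ _ = inj₁ refl
  ... | inj₂ 0F = inj₁ refl
  ... | inj₂ 1F = inj₁ refl
  ... | inj₂ (suc (suc _)) = inj₂ refl

  Forced : Subset M → Set
  Forced T = ∀ d → Nonempty (T ∩ (⁅ proj₁ (ends D d) ⁆ ∪ ⁅ proj₂ (ends D d) ⁆))

  solution⁺ : (∃[ T ] (IsSpanningTree G T × Forced T)) →
              ∃[ T⁺ ] (IsSpanningTree G⁺ T⁺ × Satisfies G⁺ T⁺ D⁺ lower (λ _ → 2))
  solution⁺ (T , (conn , acyc) , forced) =
    T⁺ , (Connected⁺ T T⁺ ∈⁺ ∈⁻ leaf∈ conn , Acyclic⁺ T T⁺ ∈⁺ ∈⁻ acyc) , λ e e∈ → lower≤ e , upper≤ e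
    where
    T⁺ : Subset (M + (3 + m))
    T⁺ = T Vec.++ ⊤
    ∈⁺ : ∀ {e} → e ∈ T → e ↑ˡ (3 + m) ∈ T⁺
    ∈⁺ {e} e∈ = lookup⇒[]= _ T⁺ (trans (lookup-++ˡ T ⊤ e) ([]=⇒lookup e∈))
    ∈⁻ : ∀ {e} → e ↑ˡ (3 + m) ∈ T⁺ → e ∈ T
    ∈⁻ {e} e∈ = lookup⇒[]= e T (trans (sym (lookup-++ˡ T ⊤ e)) ([]=⇒lookup e∈))
    leaf∈ : ∀ j → M ↑ʳ j ∈ T⁺
    leaf∈ j = lookup⇒[]= _ T⁺ (trans (lookup-++ʳ T ⊤ j) ([]=⇒lookup (∈⊤ {x = j})))
    upper≤ : ∀ e → ∣ dep D⁺ e ∩ T⁺ ∣ ≤ 2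
    upper≤ e = ≤-trans (∣p∩q∣≤∣p∣ (dep D⁺ e) T⁺) (inDegree≤2 e)
    used : ∀ i → Nonempty (dep D⁺ (target i) ∩ T⁺)
    used zero = M ↑ʳ 0F , x∈p∩q⁺ (∈-dep-target zero (inj₁ refl) , leaf∈ 0F)
    used (suc d) with forced d
    ... | e , e∈ with x∈p∩q⁻ T _ e∈
    ... | e∈T , e∈pair = e ↑ˡ (3 + m) , x∈p∩q⁺
      (∈-dep-target (suc d) (Sum.map (cong (_↑ˡ (3 + m))) (cong (_↑ˡ (3 + m))) (∈-pair⁻ e∈pair)) , ∈⁺ e∈T)
    lower≤ : ∀ e → lower e ≤ ∣ dep D⁺ e ∩ T⁺ ∣
    lower≤ e with split M e
    ... | old e rewrite lower-old e = z≤n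
    ... | new 0F rewrite lower-new 0F = z≤n
    ... | new 1F rewrite lower-new 1F = z≤n
    ... | new (suc (suc i)) rewrite lower-new (suc (suc i)) = nonempty⇒1≤∣p∣ (used i)

  solution⁻ : (∃[ T⁺ ] (IsSpanningTree G⁺ T⁺ × Satisfies G⁺ T⁺ D⁺ lower (λ _ → 2))) →
              ∃[ T ] (IsSpanningTree G T × Forced T)
  solution⁻ (T⁺ , (conn , acyc) , sat) =
    T , (Connected⁻ T T⁺ ∈⁺ ∈⁻ conn , Acyclic⁻ T T⁺ ∈⁺ ∈⁻ acyc) , forced
    where
    T : Subset M
    T = Vec.tabulate λ e → Vec.lookup T⁺ (e ↑ˡ (3 + m))
    ∈⁺ : ∀ {e} → e ∈ T → e ↑ˡ (3 + m) ∈ T⁺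
    ∈⁺ {e} e∈ = lookup⇒[]= _ T⁺ (trans (sym (lookup∘tabulate _ e)) ([]=⇒lookup e∈))
    ∈⁻ : ∀ {e} → e ↑ˡ (3 + m) ∈ T⁺ → e ∈ T
    ∈⁻ {e} e∈ = lookup⇒[]= e T (trans (lookup∘tabulate _ e) ([]=⇒lookup e∈))
    forced : Forced T
    -- Leaf edge `3 + d` lies in `T⁺` by connectedness, so its lower bound 1 is in force and some
    -- edge of its pair is in `T⁺`.
    forced d with 1≤∣p∣⇒nonempty (subst (_≤ ∣ dep D⁺ (target (suc d)) ∩ T⁺ ∣) (lower-new (suc (suc (suc d))))
                    (proj₁ (sat (target (suc d)) (leaf-used T T⁺ ∈⁺ ∈⁻ (proj₂ conn) (suc (suc (suc d)))))))
    ... | a , a∈ with x∈p∩q⁻ (dep D⁺ (target (suc d))) T⁺ a∈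
    ... | a∈dep , a∈T⁺ with ∈-dep a∈dep
    ... | i , td≡ti , a≡ with refl ← target-injective {suc d} {i} td≡ti with a≡
    ... | inj₁ refl = _ , x∈p∩q⁺ (∈⁻ a∈T⁺ , ∈-pair⁺ (inj₁ refl))
    ... | inj₂ refl = _ , x∈p∩q⁺ (∈⁻ a∈T⁺ , ∈-pair⁺ (inj₂ refl))

-- Codes of instances

-- The common form to which both the encoder's folds over tabulated lists and the program's loops
-- are reduced.
foldFin : {B : Set} (n : ℕ) → (Fin n → B → B) → B → B
foldFin zero f b = b
foldFin (suc n) f b = f zero (foldFin n (f ∘ suc) b)

foldFin-cong : ∀ {B : Set} n {f g : Fin n → B → B} → (∀ i b → f i b ≡ g i b) → ∀ b → foldFin n f b ≡ foldFin n g b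
foldFin-cong zero f≡g b = refl
foldFin-cong (suc n) {f} f≡g b = trans (cong (f zero) (foldFin-cong n (f≡g ∘ suc) b)) (f≡g zero _)

foldFin-+ : ∀ {B : Set} m n (f : Fin (m + n) → B → B) b →
            foldFin (m + n) f b ≡ foldFin m (f ∘ (_↑ˡ n)) (foldFin n (f ∘ (m ↑ʳ_)) b)
foldFin-+ zero n f b = refl
foldFin-+ (suc m) n f b = cong (f zero) (foldFin-+ m n (f ∘ suc) b)

foldr-tabulate : ∀ {A B : Set} n (c : A → B → B) b (g : Fin n → A) →
                 foldr c b (tabulate g) ≡ foldFin n (c ∘ g) b
foldr-tabulate zero c b g = refl
foldr-tabulate (suc n) c b g = cong (c (g zero)) (foldr-tabulate n c b (g ∘ suc))

foldr-concat-tabulate : ∀ {A B : Set} n (c : A → B → B) b (g : Fin n → List A) →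
                        foldr c b (concat (tabulate g)) ≡ foldFin n (λ i b → foldr c b (g i)) b
foldr-concat-tabulate zero c b g = refl
foldr-concat-tabulate (suc n) c b g =
  trans (foldr-++ c b (g zero) _) (cong (λ b → foldr c b (g zero)) (foldr-concat-tabulate n c b (g ∘ suc)))

iterateℕ-foldFin : ∀ {B : Set} k (f : ℕ → B → B) b → iterateℕ f k b ≡ foldFin k (f ∘ toℕ) b
iterateℕ-foldFin zero f b = refl
iterateℕ-foldFin (suc k) f b = trans (first f k b) (cong (f 0) (iterateℕ-foldFin k (f ∘ suc) b))
  where
  first : ∀ {B : Set} (f : ℕ → B → B) k b → iterateℕ f (suc k) b ≡ f 0 (iterateℕ (f ∘ suc) k b)
  first f zero b = refl
  first f (suc k) b = first f k (f (suc k) b)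

-- In the reversed list exactly `toℕ i` entries follow the one with index `i`, so the length that
-- the step sees is that index.
iterateList-reverse : ∀ {A B : Set} n (f : ℕ → A → B → B) (g : Fin n → A) b →
  iterateList (f ∘ length) (reverse (tabulate g)) b ≡ foldFin n (λ i → f (toℕ i) (g i)) b
iterateList-reverse n f g b =
  trans (go n g [] b) (foldFin-cong n (λ i b → cong (λ k → f k (g i) b) (+-identityʳ (toℕ i))) b)
  where
  go : ∀ n (g : Fin n → _) ys b → iterateList (f ∘ length) (tabulate g ʳ++ ys) b ≡
       iterateList (f ∘ length) ys (foldFin n (λ i → f (toℕ i + length ys) (g i)) b)
  go zero g ys b = refl
  go (suc n) g ys b = trans (go n (g ∘ suc) (g zero ∷ ys) b)
    (cong (iterateList (f ∘ length) ys ∘ f (length ys) (g zero))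
      (foldFin-cong n (λ i b → cong (λ k → f k (g (suc i)) b) (+-suc (toℕ i) (length ys))) b))

encodeℕ-++ : ∀ k r → encodeℕ k ++ r ≡ ones k (false ∷ r)
encodeℕ-++ zero r = refl
encodeℕ-++ (suc k) r = cong (true ∷_) (encodeℕ-++ k r)

encodeList-++ : ∀ {A : Set} (enc : A → List Bool) xs r →
                encodeList enc xs ++ r ≡ foldr (λ x r → true ∷ enc x ++ r) (false ∷ r) xs
encodeList-++ enc [] r = refl
encodeList-++ enc (x ∷ xs) r = cong (true ∷_) (begin
  ((enc x ++ _) ++ [ false ]) ++ r ≡⟨ cong (_++ r) (++-assoc (enc x) _ _) ⟩
  (enc x ++ encodeList enc xs) ++ r ≡⟨ ++-assoc (enc x) _ r ⟩
  enc x ++ encodeList enc xs ++ r ≡⟨ cong (enc x ++_) (encodeList-++ enc xs r) ⟩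
  enc x ++ foldr _ (false ∷ r) xs ∎)
  where open ≡-Reasoning

toℕs : ∀ {n} → Fin n × Fin n → ℕ × ℕ
toℕs = Product.map toℕ toℕ

encodePair-++ : ∀ {n} (p : Fin n × Fin n) r → true ∷ encodePair p ++ r ≡ pairOn (toℕs p) r
encodePair-++ (i , j) r = cong (true ∷_) (trans (++-assoc (encodeℕ (toℕ i)) _ r)
  (trans (encodeℕ-++ (toℕ i) _) (cong (λ r → ones (toℕ i) (false ∷ r)) (encodeℕ-++ (toℕ j) r))))

edges : ∀ {n} → Graph n → List (ℕ × ℕ)
edges G = tabulate (toℕs ∘ ends G)

encodeEdges-++ : ∀ {n} (G : Graph n) r → encodeEdges G ++ r ≡ foldFin (size G) (λ e → pairOn (toℕs (ends G e))) (false ∷ r)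
encodeEdges-++ G r = trans (encodeList-++ encodePair (tabulate (ends G)) r)
  (trans (foldr-tabulate _ _ _ (ends G)) (foldFin-cong _ (encodePair-++ ∘ ends G) _))

encode-FCST : ∀ {n} (G : Graph n) (D : Graph (size G)) →
              encode FCST (record { G = G ; D = D }) ≡ input n (edges G) (edges D)
encode-FCST {n} G D = trans (encodeℕ-++ n _) (cong (λ r → ones n (false ∷ r))
  (trans (encodeEdges-pairsOn G _) (cong (λ r → pairsOn (edges G) (false ∷ r))
    (trans (sym (++-identityʳ _)) (encodeEdges-pairsOn D [])))))
  where
  encodeEdges-pairsOn : ∀ {n} (G : Graph n) r → encodeEdges G ++ r ≡ pairsOn (edges G) (false ∷ r)
  encodeEdges-pairsOn G r = trans (encodeEdges-++ G r) (sym (foldr-tabulate _ pairOn _ (toℕs ∘ ends G)))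

-- The code of the constructed instance

module _ {n : ℕ} (G : Graph (suc n)) (D : Graph (size G)) where

  open Constraints G D

  instance⁺ : DCSTInstance
  instance⁺ = record { G = G⁺ ; D = D⁺ ; ℓ = lower ; u = λ _ → 2 }

  construct : Instance G-DCST*
  construct = instance⁺ , (λ _ → refl) , lower∈01 , maxInDegree≡2

  private
    -- Left, the index of leaf edge `3 + k`; right, the value of the counter `#c` when the program
    -- writes it.
    target-counter : ∀ k → M + (3 + k) ≡ suc k + (2 + M)
    target-counter k = trans (+-comm M (3 + k)) (cong suc (sym (trans (+-suc k (suc M)) (cong suc (+-suc k M)))))

  encodeEdges⁺ : ∀ r → encodeEdges G⁺ ++ r ≡
    iterateList (λ _ → pairOn) (reverse (edges G)) (iterateℕ (pendantOn (suc n)) (3 + m) (false ∷ r))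
  encodeEdges⁺ r = begin
    encodeEdges G⁺ ++ r
      ≡⟨ encodeEdges-++ G⁺ r ⟩
    foldFin (M + (3 + m)) (λ e → pairOn (toℕs (ends⁺ e))) (false ∷ r)
      ≡⟨ foldFin-+ M (3 + m) _ _ ⟩
    foldFin M (λ e → pairOn (toℕs (ends⁺ (e ↑ˡ (3 + m)))))
      (foldFin (3 + m) (λ j → pairOn (toℕs (ends⁺ (M ↑ʳ j)))) (false ∷ r))
      ≡⟨ cong (foldFin M _) (foldFin-cong (3 + m) (λ j r → cong (λ p → pairOn p r) (new-ends j)) (false ∷ r)) ⟩
    foldFin M (λ e → pairOn (toℕs (ends⁺ (e ↑ˡ (3 + m))))) (foldFin (3 + m) (pendantOn (suc n) ∘ toℕ) (false ∷ r))
      ≡⟨ foldFin-cong M (λ e r → cong (λ p → pairOn p r) (old-ends e)) _ ⟩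
    foldFin M (λ e → pairOn (toℕs (ends G e))) (foldFin (3 + m) (pendantOn (suc n) ∘ toℕ) (false ∷ r))
      ≡⟨ iterateList-reverse M (λ _ → pairOn) (toℕs ∘ ends G) _ ⟨
    iterateList (λ _ → pairOn) (reverse (edges G)) (foldFin (3 + m) (pendantOn (suc n) ∘ toℕ) (false ∷ r))
      ≡⟨ cong (iterateList (λ _ → pairOn) (reverse (edges G))) (iterateℕ-foldFin (3 + m) (pendantOn (suc n)) _) ⟨
    iterateList (λ _ → pairOn) (reverse (edges G)) (iterateℕ (pendantOn (suc n)) (3 + m) (false ∷ r)) ∎
    where
    open ≡-Reasoning
    old-ends : ∀ e → toℕs (ends⁺ (e ↑ˡ (3 + m))) ≡ toℕs (ends G e)
    old-ends e = trans (cong toℕs (ends⁺-old e)) (cong₂ _,_ (toℕ-↑ˡ _ (3 + m)) (toℕ-↑ˡ _ (3 + m)))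
    new-ends : ∀ j → toℕs (ends⁺ (M ↑ʳ j)) ≡ (0 , toℕ j + suc n)
    new-ends j = trans (cong toℕs (ends⁺-new j)) (cong (0 ,_) (trans (toℕ-↑ʳ (suc n) j) (+-comm (suc n) (toℕ j))))

  encodeArcs⁺ : ∀ r → encodeArcs D⁺ ++ r ≡
    pairOn (M , 2 + M) (pairOn (suc M , 2 + M) (constraintsOn M (reverse (edges D)) (false ∷ r)))
  encodeArcs⁺ r = begin
    encodeArcs D⁺ ++ r
      ≡⟨ encodeList-++ encodePair (arcs D⁺) r ⟩
    foldr arcOn (false ∷ r) (concat (tabulate arcsTo))
      ≡⟨ foldr-concat-tabulate (suc m) arcOn (false ∷ r) arcsTo ⟩
    foldFin (suc m) (λ i r → foldr arcOn r (arcsTo i)) (false ∷ r)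
      ≡⟨ foldFin-cong (suc m) {g = arcsToOn} (λ i r → trans (encodePair-++ (proj₁ (pair i) , target i) _)
           (cong (pairOn _) (encodePair-++ (proj₂ (pair i) , target i) r))) (false ∷ r) ⟩
    arcsToOn zero (foldFin m (arcsToOn ∘ suc) (false ∷ r))
      ≡⟨ cong₂ (λ p q → pairOn p (pairOn q (foldFin m (arcsToOn ∘ suc) (false ∷ r))))
           (cong₂ _,_ first third) (cong₂ _,_ second third) ⟩
    specialOn (foldFin m (arcsToOn ∘ suc) (false ∷ r))
      ≡⟨ cong specialOn (foldFin-cong m (λ d r → cong₂ (λ p q → pairOn p (pairOn q r))
           (cong₂ _,_ (toℕ-↑ˡ (proj₁ (ends D d)) (3 + m)) (next d))
           (cong₂ _,_ (toℕ-↑ˡ (proj₂ (ends D d)) (3 + m)) (next d))) (false ∷ r)) ⟩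
    specialOn (foldFin m (λ d → arcsOn (suc (toℕ d) + (2 + M)) (toℕs (ends D d))) (false ∷ r))
      ≡⟨ cong specialOn (iterateList-reverse m (λ k → arcsOn (suc k + (2 + M))) (toℕs ∘ ends D) (false ∷ r)) ⟨
    specialOn (constraintsOn M (reverse (edges D)) (false ∷ r)) ∎
    where
    open ≡-Reasoning
    arcOn : Edge G⁺ × Edge G⁺ → List Bool → List Bool
    arcOn x r = true ∷ encodePair x ++ r
    arcsToOn : Fin (suc m) → List Bool → List Bool
    arcsToOn i r = pairOn (toℕs (proj₁ (pair i) , target i)) (pairOn (toℕs (proj₂ (pair i) , target i)) r)
    specialOn : List Bool → List Bool
    specialOn r = pairOn (M , 2 + M) (pairOn (suc M , 2 + M) r)
    first : toℕ (M ↑ʳ (zero {2 + m})) ≡ M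
    first = trans (toℕ-↑ʳ M (zero {2 + m})) (+-identityʳ M)
    second : toℕ (M ↑ʳ (suc {2 + m} zero)) ≡ suc M
    second = trans (toℕ-↑ʳ M (suc {2 + m} zero)) (+-comm M 1)
    third : toℕ (target 0F) ≡ 2 + M
    third = trans (toℕ-↑ʳ M (suc {2 + m} (suc {1 + m} zero))) (+-comm M 2)
    next : ∀ d → toℕ (target (suc d)) ≡ suc (toℕ d) + (2 + M)
    next d = trans (toℕ-↑ʳ M (suc (suc (suc d)))) (target-counter (toℕ d))

  encodeLower : ∀ r → encodeList encodeℕ (tabulate lower) ++ r ≡
    iterateℕ (λ _ → lower0On) (2 + M) (iterateℕ (λ _ → lower1On) (1 + m) (false ∷ r))
  encodeLower r = begin
    encodeList encodeℕ (tabulate lower) ++ r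
      ≡⟨ encodeList-++ encodeℕ (tabulate lower) r ⟩
    foldr (λ x r → true ∷ encodeℕ x ++ r) (false ∷ r) (tabulate lower)
      ≡⟨ foldr-tabulate (M + (3 + m)) _ _ lower ⟩
    foldFin (M + (3 + m)) (λ e r → true ∷ encodeℕ (lower e) ++ r) (false ∷ r)
      ≡⟨ foldFin-+ M (3 + m) _ _ ⟩
    foldFin M (λ e r → true ∷ encodeℕ (lower (e ↑ˡ (3 + m))) ++ r)
      (foldFin (3 + m) (λ j r → true ∷ encodeℕ (lower (M ↑ʳ j)) ++ r) (false ∷ r))
      ≡⟨ foldFin-cong M (λ e r → cong (λ k → true ∷ encodeℕ k ++ r) (lower-old e)) _ ⟩
    foldFin M (λ _ → lower0On) (foldFin (3 + m) (λ j r → true ∷ encodeℕ (lower (M ↑ʳ j)) ++ r) (false ∷ r))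
      ≡⟨ cong (foldFin M _) (foldFin-cong (3 + m) (λ j r → cong (λ k → true ∷ encodeℕ k ++ r) (lower-new j)) _) ⟩
    foldFin M (λ _ → lower0On) (lower0On (lower0On (foldFin (1 + m) (λ _ → lower1On) (false ∷ r))))
      ≡⟨ cong (foldFin M _ ∘ lower0On ∘ lower0On) (iterateℕ-foldFin (1 + m) (λ _ → lower1On) (false ∷ r)) ⟨
    foldFin M (λ _ → lower0On) (lower0On (lower0On (iterateℕ (λ _ → lower1On) (1 + m) (false ∷ r))))
      -- The zeros of leaf edges 0 and 1 are absorbed by computation, since `iterateℕ` performs its
      -- first rounds innermost.
      ≡⟨ iterateℕ-foldFin M (λ _ → lower0On) _ ⟨
    iterateℕ (λ _ → lower0On) (2 + M) (iterateℕ (λ _ → lower1On) (1 + m) (false ∷ r)) ∎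
    where open ≡-Reasoning

  encodeUpper : encodeList encodeℕ (tabulate {n = M + (3 + m)} (λ _ → 2)) ≡
    iterateℕ (λ _ → upperOn) (3 + (m + M)) (false ∷ [])
  encodeUpper = begin
    encodeList encodeℕ twos
      ≡⟨ ++-identityʳ (encodeList encodeℕ twos) ⟨
    encodeList encodeℕ twos ++ []
      ≡⟨ encodeList-++ encodeℕ twos [] ⟩
    foldr (λ x r → true ∷ encodeℕ x ++ r) (false ∷ []) twos
      ≡⟨ foldr-tabulate (M + (3 + m)) _ _ (λ _ → 2) ⟩
    foldFin (M + (3 + m)) (λ _ → upperOn) (false ∷ [])
      ≡⟨ iterateℕ-foldFin (M + (3 + m)) (λ _ → upperOn) _ ⟨
    iterateℕ (λ _ → upperOn) (M + (3 + m)) (false ∷ [])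
      ≡⟨ cong (λ k → iterateℕ (λ _ → upperOn) k (false ∷ [])) (+-comm M (3 + m)) ⟩
    iterateℕ (λ _ → upperOn) (3 + (m + M)) (false ∷ []) ∎
    where
    open ≡-Reasoning
    twos = tabulate {n = M + (3 + m)} (λ _ → 2)

  encode-construct : encode G-DCST* construct ≡ output (suc n) m M (reverse (edges G)) (reverse (edges D))
  encode-construct = begin
    encodeℕ (suc n + (3 + m)) ++ r₁
      ≡⟨ encodeℕ-++ (suc n + (3 + m)) r₁ ⟩
    ones (suc n + (3 + m)) (false ∷ r₁)
      ≡⟨ ones-+ (suc n) (3 + m) (false ∷ r₁) ⟨
    ones (suc n) (ones (3 + m) (false ∷ r₁))
      ≡⟨ cong (λ r → ones (suc n) (ones (3 + m) (false ∷ r))) (trans (encodeEdges⁺ r₂)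
           (cong (λ r → iterateList (λ _ → pairOn) (reverse (edges G)) (iterateℕ (pendantOn (suc n)) (3 + m) (false ∷ r)))
             (trans (encodeArcs⁺ r₃)
               (cong (λ r → pairOn (M , 2 + M) (pairOn (suc M , 2 + M) (constraintsOn M (reverse (edges D)) (false ∷ r))))
                 (trans (encodeLower r₄)
                   (cong (λ r → iterateℕ (λ _ → lower0On) (2 + M) (iterateℕ (λ _ → lower1On) (1 + m) (false ∷ r)))
                     encodeUpper)))))) ⟩
    output (suc n) m M (reverse (edges G)) (reverse (edges D)) ∎
    where
    open ≡-Reasoning
    r₄ = encodeList encodeℕ (tabulate {n = M + (3 + m)} (λ _ → 2))
    r₃ = encodeList encodeℕ (tabulate lower) ++ r₄
    r₂ = encodeArcs D⁺ ++ r₃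
    r₁ = encodeEdges G⁺ ++ r₂

-- The reduction

edgeless : ∀ n → Graph n
edgeless n = record { size = 0 ; ends = λ () ; ordered = λ () ; simple = λ { {()} } }

record Pointed : Set where
  constructor pointed
  field
    {k} : ℕ
    G   : Graph (suc k)
    D   : Graph (size G)

forget : Pointed → FCSTInstance
forget (pointed G D) = record { G = G ; D = D }

-- A graph without vertices has no spanning tree, and neither has the edgeless graph on two vertices.
point : FCSTInstance → Pointed
point record { n = zero } = pointed (edgeless 2) (edgeless 0)
point record { n = suc _ ; G = G ; D = D } = pointed G D

point-Yes : ∀ x → Yes FCST x ⇔ Yes FCST (forget (point x))
point-Yes record { n = suc _ } = mk⇔ (λ y → y) (λ y → y)
point-Yes record { n = zero } = mk⇔
  (λ { (_ , ((() , _) , _) , _) })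
  λ { (T , ((_ , conn) , _) , _) → contradiction (conn zero (suc zero)) (isolated T) }
  where
  isolated : ∀ T → ¬ Star (Adjacent (edgeless 2) T) zero (suc zero)
  isolated T ((() , _) ◅ _)

reduce : Instance FCST → Instance G-DCST*
reduce x = construct G D where open Pointed (point x)

reduce-Yes : ∀ x → Yes FCST x ⇔ Yes G-DCST* (reduce x)
reduce-Yes x = mk⇔ (solution⁺ ∘ to) (from ∘ solution⁻)
  where
  open Pointed (point x)
  open Constraints G D using (solution⁺; solution⁻)
  open Equivalence (point-Yes x)

-- A leading `false` means that there are no vertices, and then the code is just three `false`. Two
-- ones in front turn it into the code of the edgeless graph on two vertices with an empty `D`.
prepare : Prog 10
prepare = case #io skip (push #io true ⨾ push #io true) skip

encode-vertexless : (G : Graph 0) (D : Graph (size G)) →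
                    encode FCST (record { G = G ; D = D }) ≡ false ∷ false ∷ false ∷ []
encode-vertexless record { size = zero } record { size = zero } = refl
encode-vertexless record { size = zero } record { size = suc _ ; ends = ends } with () ← proj₁ (ends zero)
encode-vertexless record { size = suc _ ; ends = ends } _ with () ← proj₁ (ends zero)

length-point : ∀ x → length (encode FCST (forget (point x))) ≤ 2 + length (encode FCST x)
length-point record { n = zero ; G = G ; D = D } =
  ≤-reflexive (cong (λ xs → 2 + length xs) (sym (encode-vertexless G D)))
length-point record { n = suc _ } = m≤n+m _ 2

length-ones : ∀ k r → length (ones k r) ≡ k + length r
length-ones zero r = refl
length-ones (suc k) r = cong suc (length-ones k r)

-- Every pair starts with a `true`, so the code is at least as long as the number of edges. That
-- bounds the loops over edges and the edge indices occurring in `D`.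
length-pairsOn : ∀ ps r → length ps + length r ≤ length (pairsOn ps r)
length-pairsOn [] r = ≤-refl
length-pairsOn ((i , j) ∷ ps) r = s≤s (begin
  length ps + length r                            ≤⟨ length-pairsOn ps r ⟩
  length rest                                     ≤⟨ n≤1+n _ ⟩
  length (false ∷ rest)                           ≤⟨ length≤ones j _ ⟩
  length (ones j (false ∷ rest))                  ≤⟨ n≤1+n _ ⟩
  length (false ∷ ones j (false ∷ rest))          ≤⟨ length≤ones i _ ⟩
  length (ones i (false ∷ ones j (false ∷ rest))) ∎)
  where
  open ≤-Reasoning
  rest = pairsOn ps r
  length≤ones : ∀ k r → length r ≤ length (ones k r)
  length≤ones k r = ≤-trans (m≤n+m _ k) (≤-reflexive (sym (length-ones k r)))

length-input : ∀ n es ds → n + (length es + length ds) ≤ length (input n es ds)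
length-input n es ds = begin
  n + (length es + length ds)
    ≤⟨ +-monoʳ-≤ n (+-monoʳ-≤ (length es) (≤-trans (m≤m+n _ 1) (≤-trans (length-pairsOn ds _) (n≤1+n _)))) ⟩
  n + (length es + length (false ∷ pairsOn ds (false ∷ [])))
    ≤⟨ +-monoʳ-≤ n (≤-trans (length-pairsOn es _) (n≤1+n _)) ⟩
  n + length (false ∷ pairsOn es (false ∷ pairsOn ds (false ∷ [])))
    ≡⟨ length-ones n _ ⟨
  length (input n es ds)                      ∎
  where open ≤-Reasoning

edges-small : ∀ {n L} (G : Graph n) → n ≤ L → All (Small L) (edges G)
edges-small G n≤L = Allₚ.tabulate⁺ λ e → <⇒≤ (<-≤-trans (toℕ<n _) n≤L) , <⇒≤ (<-≤-trans (toℕ<n _) n≤L)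

program : Prog 10
program = prepare ⨾ main

initial final : FCSTInstance → State 10
initial x = encode FCST x ∷ Vec.replicate 9 []
final x =
  encode G-DCST* (reduce x) ∷ [] ∷ [] ∷ ones (size (Pointed.G (point x))) [] ∷ Vec.replicate 6 []

module _ (L : ℕ) where
  open Timed L

  prepare! : ∀ x → prepare ⊢ encode FCST x ∷ Vec.replicate 9 [] ⇓≤[ con 1 ⊕ con 2 ]
                             encode FCST (forget (point x)) ∷ Vec.replicate 9 []
  prepare! record { n = zero ; G = G ; D = D } =
    from-≡ (cong (Vec._∷ Vec.replicate 9 []) (sym (encode-vertexless G D))) (case! ops!)
  prepare! record { n = suc _ } = case! (timed skip (s≤s z≤n))

  -- prepare lengthens the input by at most 2, and there are 3 more leaves than edges of D.
  program! : ∀ x → 5 + length (encode FCST x) ≤ L → program ⊢ initial x ⇓≤[ _ ] final x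
  program! x ≤L = prepare! x ▹ from-≡ (cong (Vec._∷ Vec.replicate 9 []) (sym (encode-FCST G D)))
    (to-≡ (cong (λ o → o ∷ [] ∷ [] ∷ ones (size G) [] ∷ Vec.replicate 6 []) (sym (encode-construct G D)))
      (main! L (suc k) m M (edges G) (edges D) (length-tabulate (toℕs ∘ ends G)) (length-tabulate (toℕs ∘ ends D))
        (edges-small G (≤-trans (m≤n+m (suc k) (3 + m)) n≤L)) (edges-small D (≤-trans (m≤n+m M (3 + m)) M≤L)) n≤L M≤L))
    where
    open Pointed (point x)
    m = size D
    M = size G
    total≤L : 3 + (suc k + (M + m)) ≤ L
    total≤L = begin
      3 + (suc k + (M + m))
        ≡⟨ cong₂ (λ M m → 3 + (suc k + (M + m)))
             (length-tabulate (toℕs ∘ ends G)) (length-tabulate (toℕs ∘ ends D)) ⟨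
      3 + (suc k + (length (edges G) + length (edges D))) ≤⟨ +-monoʳ-≤ 3 (length-input (suc k) (edges G) (edges D)) ⟩
      3 + length (input (suc k) (edges G) (edges D)) ≡⟨ cong (λ xs → 3 + length xs) (encode-FCST G D) ⟨
      3 + length (encode FCST (forget (point x))) ≤⟨ +-monoʳ-≤ 3 (length-point x) ⟩
      5 + length (encode FCST x) ≤⟨ ≤L ⟩
      L ∎
      where open ≤-Reasoning
    n≤L : 3 + (m + suc k) ≤ L
    n≤L = ≤-trans (+-monoʳ-≤ 3 (≤-trans (≤-reflexive (+-comm m (suc k))) (+-monoʳ-≤ (suc k) (m≤n+m m M)))) total≤L
    M≤L : 3 + (m + M) ≤ L
    M≤L = ≤-trans (+-monoʳ-≤ 3 (≤-trans (≤-reflexive (+-comm m M)) (m≤n+m (M + m) (suc k)))) total≤L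

reduce-PolyTime : PolyTime FCST G-DCST* reduce
reduce-PolyTime = bounded _ program!
  where
  open Timed using (_⊢_⇓≤[_]_; run; steps≤)
  -- `P` is bound before `L` and `x`, so `_` must be solved by one polynomial for all instances.
  -- Taking `L` to be the code length plus 5 explains the shift in `⟦⟧-polynomial P 5`.
  bounded : ∀ P → (∀ L x → 5 + length (encode FCST x) ≤ L → _⊢_⇓≤[_]_ L program (initial x) P (final x)) →
            PolyTime FCST G-DCST* reduce
  bounded P runs =
    let c , d , bound = ⟦⟧-polynomial P 5 in
    9 , program , c , d , λ x →
      let r = runs (5 + length (encode FCST x)) x ≤-refl
      in _ , final x , run r , refl , ≤-trans (steps≤ r) (bound (length (encode FCST x)))

theorem8 : FCST ≤ᵖ G-DCST*
theorem8 = reduce , reduce-Yes , reduce-PolyTime
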